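{- For every $n\ge0$, the number of overpartitions of $n$ of the form $(\pi_1,\ldots,\pi_s)$ with $\pi_i\ge\pi_{i+1}$, such that $\pi_i\ge\pi_{i+2}+1$ (whenever $i+2\le s$) with strict inequality if $\pi_i$ is non-overlined, and such that whenever $\pi_i\le\pi_{i+1}+1$ with strict inequality if $\pi_i$ is overlined, then $|\pi_i|+|\pi_{i+1}|\equiv 1+\overline{V}(\pi_i)\pmod 2$, equals the number of overpartitions of $n$ whose non-overlined parts are all $\equiv1$ or $4\pmod5$.
   Context: An overpartition of $n$ is a partition of $n$ in which the first occurrence of a part size may be overlined. Parts are totally ordered by $1<\bar1<2<\bar2<\cdots$; overpartitions are listed in weakly decreasing order in this order, and all inequalities between parts are in this order, where $x+1$ denotes the part of size $|x|+1$ overlined iff $x$ is. $|x|$ is the size of a part. $\overline{V}(N)$ is the number of overlined parts of the overpartition that are $\le N$ in this order. -}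

module Defs where

open import Data.Nat using (ℕ; zero; suc; _+_; _*_; _≤ᵇ_; _≡ᵇ_; _%_)
open import Data.Bool using (Bool; true; false; _∧_; _∨_; not; if_then_else_; T)
open import Data.List using (List; []; _∷_; map; length)
open import Data.Nat.ListAction using (sum)
open import Data.Product using (_×_; _,_; proj₁; proj₂; Σ)
open import Function.Bundles using (_↔_)

allB : {A : Set} → (A → Bool) → List A → Bool
allB p [] = true
allB p (x ∷ xs) = p x ∧ allB p xs

countB : {A : Set} → (A → Bool) → List A → ℕ
countB p [] = 0
countB p (x ∷ xs) = (if p x then 1 else 0) + countB p xs

Part : Set
Part = ℕ × Bool

size : Part → ℕ
size = proj₁

over : Part → Bool
over = proj₂

-- Total order 1 < 1̄ < 2 < 2̄ < ... : rank of a part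
key : Part → ℕ
key (k , b) = 2 * k + (if b then 1 else 0)

_≼_ : Part → Part → Bool
x ≼ y = key x ≤ᵇ key y

_≺_ : Part → Part → Bool
x ≺ y = suc (key x) ≤ᵇ key y

succP : Part → Part
succP (k , b) = (suc k , b)

allPos : List Part → Bool
allPos = allB (λ p → 1 ≤ᵇ size p)

sortedDec : List Part → Bool
sortedDec (x ∷ y ∷ r) = (y ≼ x) ∧ sortedDec (y ∷ r)
sortedDec _ = true

overDistinct : List Part → Bool
overDistinct [] = true
overDistinct (x ∷ r) =
  (not (over x) ∨ allB (λ y → not (over y ∧ (size y ≡ᵇ size x))) r) ∧ overDistinct r

isOverpartition : ℕ → List Part → Bool
isOverpartition n π =
  allPos π ∧ sortedDec π ∧ overDistinct π ∧ (sum (map size π) ≡ᵇ n)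

Vbar : List Part → Part → ℕ
Vbar π N = countB (λ p → over p ∧ (p ≼ N)) π

gapCond : List Part → Bool
gapCond (x ∷ y ∷ z ∷ r) =
  (if over x then succP z ≼ x else succP z ≺ x) ∧ gapCond (y ∷ z ∷ r)
gapCond _ = true

-- whenever π_i ≤ π_{i+1} + 1 (strict if π_i overlined),
-- |π_i| + |π_{i+1}| ≡ 1 + V̄(π_i) (mod 2); π is the whole overpartition
parityCond : List Part → List Part → Bool
parityCond π (x ∷ y ∷ r) =
  (if (if over x then x ≺ succP y else x ≼ succP y)
     then (((size x + size y) % 2) ≡ᵇ ((1 + Vbar π x) % 2))
     else true)
  ∧ parityCond π (y ∷ r)
parityCond π _ = true

lhsPred : ℕ → List Part → Bool
lhsPred n π = isOverpartition n π ∧ gapCond π ∧ parityCond π π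

rhsPred : ℕ → List Part → Bool
rhsPred n π = isOverpartition n π ∧
  allB (λ p → over p ∨ ((size p % 5) ≡ᵇ 1) ∨ ((size p % 5) ≡ᵇ 4)) π

LHS : ℕ → Set
LHS n = Σ (List Part) (λ π → T (lhsPred n π))

RHS : ℕ → Set
RHS n = Σ (List Part) (λ π → T (rhsPred n π))

{-# OPTIONS --safe #-}
module Submission where

-- Record an overpartition by its frequencies f_l and f̄_l.  The gap condition says that the window
-- f_l + f̄_l + f_{l+1} is at most 2, and the parity condition only restricts windows equal to 2.  So the parts can be
-- added size by size, remembering c = f_l + f̄_l and the parity of the number of overlined parts so far.  With
-- D_N = ∏_{m>N} (1 + q^m) and any solution of G_N = G_{N+1} + q^{N+1} G_{N+2}, G_N → 1, the generating function of the
-- ways to add parts larger than N is D_N G_N, D_N G_{N+1} or D_{N+1} G_N, depending on the state; hence the left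
-- side has generating function (-q)_∞ G_0.  Rogers and Ramanujan solve the recurrence by
-- (q)_∞ G_N = Σ_n (-1)^n q^{2Nn + n(5n+1)/2} (1 - q^{2N+4n+2}) (1 - q^{n+1}) ⋯ (1 - q^{n+N}), which at N = 0 is a theta
-- series, so that Jacobi's triple product identity gives G_0 = 1 / ∏ (1 - q^{5i+1}) (1 - q^{5i+4}).
-- Everything takes place modulo q^{n+1}, where all sums and products are finite.

-- The conditions on a part involve only parts that do not exceed it, because `Vbar` at that part
-- counts nothing larger; this is what allows building from small sizes to large. The generating
-- functions claimed for the states are confirmed by an invariant: the sum of weight times
-- completion series over all configurations with sizes up to N does not depend on N, since adding
-- one size amounts to the recurrences of D and G. At N = 0 it is D_0 G_0; for large N the
-- completion series are 1, and it is the generating function sought. The obstacle is division.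
-- Everything is multiplied by (q)_∞, Gaussian binomials are replaced by products of tails, and
-- factors 1 - q^m are cancelled at the end, which is legitimate because q is nilpotent. The
-- identities hold in any commutative ring with q^K = 0; only the last step reads off a coefficient
-- of an integer series.

open import Defs
open import Algebra.Bundles using (CommutativeRing)
import Algebra.Properties.Semiring.Exp as Exp
import Algebra.Solver.Ring
open import Algebra.Solver.Ring.AlmostCommutativeRing using (fromCommutativeRing; _-Raw-AlmostCommutative⟶_)
open import Data.Bool.Base using (Bool; true; false; not; _∧_; _∨_; _xor_; if_then_else_; T)
open import Data.Bool.Properties using (T-≡; T-∧; T-irrelevant; ∧-assoc; ∧-comm; ∧-identityʳ; ∧-zeroʳ; not-involutive)
open import Data.Empty using (⊥-elim)
open import Data.Fin.Base using (Fin)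
open import Data.Fin.Properties using (+↔⊎; 0↔⊥; 1↔⊤)
open import Data.Integer.Base as ℤ using (ℤ; +_; -[1+_]; 0ℤ; 1ℤ)
import Data.Integer.Properties as ℤ
open import Data.Integer.Solver using (module +-*-Solver)
open import Data.List.Base using (List; []; _∷_; map)
open import Data.List.Relation.Unary.All as All using (All; []; _∷_)
import Data.Maybe.Base as Maybe
open import Data.Nat using (ℕ)
open import Data.Nat.Base as ℕ using (zero; suc; _≤_; _<_; z≤n; s≤s; _∸_; _%_; _≡ᵇ_; _≤ᵇ_)
open import Data.Nat.DivMod using ([m+n]%n≡m%n; [m+kn]%n≡m%n)
open import Data.Nat.ListAction using (sum)
import Data.Nat.Properties as ℕ
open import Data.Product.Base using (Σ; _×_; _,_; proj₁; proj₂)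
open import Data.Sum.Base using (_⊎_; inj₁; inj₂)
open import Data.Sum.Function.Propositional using (_⊎-↔_)
open import Data.Unit.Base using (⊤; tt)
open import Function.Base using (_∘_)
open import Function.Bundles using (_↔_; mk↔ₛ′; Equivalence)
open import Function.Properties.Inverse using (↔-refl; ↔-sym; ↔-trans)
open import Level using (0ℓ)
open import Relation.Binary.PropositionalEquality as ≡ using (_≡_)
open import Relation.Nullary using (¬_; yes; no)
open import Relation.Nullary.Decidable using (dec⇒maybe)

-- The frequency form of an overpartition with parts of size at most N: at each size, whether it occurs
-- overlined and how often it occurs non-overlined.
OP : ℕ → Set
OP zero    = ⊤
OP (suc N) = Bool × ℕ × OP N

bit : Bool → ℕ
bit false = 0
bit true  = 1

weight : ∀ N → OP N → ℕ
weight zero    _           = 0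
weight (suc N) (b , f , o) = (bit b ℕ.+ f) ℕ.* suc N ℕ.+ weight N o

topCount : ∀ N → OP N → ℕ
topCount zero    _           = 0
topCount (suc N) (b , f , _) = bit b ℕ.+ f

oddOver : ∀ N → OP N → Bool
oddOver zero    _           = false
oddOver (suc N) (b , _ , o) = b xor oddOver N o

-- The gap and parity conditions on f non-overlined parts of one size, given the number c of parts of the size below
-- and whether an odd number of smaller parts is overlined; overFits concerns the overlined part of the same size.
fits : ℕ → ℕ → Bool → Bool
fits 0                   _             _ = true
fits 1                   0             _ = true
fits 1                   1             v = not v
fits 1                   (suc (suc _)) _ = false
fits 2                   0             v = v
fits 2                   (suc _)       _ = false
fits (suc (suc (suc _))) _             _ = false

overFits : Bool → Bool → ℕ → Bool
overFits _ false _             = true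
overFits _ true  0             = true
overFits v true  1             = not v
overFits _ true  (suc (suc _)) = false

step : ℕ → Bool → Bool → ℕ → Bool
step c v b f = fits f c v ∧ overFits v b f

good : ∀ N → OP N → Bool
good zero    _           = true
good (suc N) (b , f , o) = good N o ∧ step (topCount N o) (oddOver N o) b f

±1mod5 : ℕ → Bool
±1mod5 m = (m % 5 ≡ᵇ 1) ∨ (m % 5 ≡ᵇ 4)

allows : ℕ → ℕ → Bool
allows m zero    = true
allows m (suc f) = ±1mod5 m

restricted : ∀ N → OP N → Bool
restricted zero    _           = true
restricted (suc N) (_ , f , o) = restricted N o ∧ allows (suc N) f

-- Finite sums over frequency forms

module Summation {A : Set} (_⊕_ : A → A → A) (z : A) where

  Σ< : ℕ → (ℕ → A) → A
  Σ< zero    f = z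
  Σ< (suc n) f = Σ< n f ⊕ f n

  -- The largest size is summed innermost, so that its options can be collected while the smaller
  -- parts stay fixed; every induction on N uses this.
  ΣOP : ℕ → ∀ N → (OP N → A) → A
  ΣOP B zero    φ = φ tt
  ΣOP B (suc N) φ = ΣOP B N (λ o → Σ< B (λ f → φ (false , f , o)) ⊕ Σ< B (λ f → φ (true , f , o)))

-- One induction serves three purposes: congruence of sums, pulling out a constant factor, and, with
-- the relation `f n ≡ + k`, passing from a sum of series to a count.
module SummationRel {A A′ : Set} (_⊕_ : A → A → A) (z : A) (_⊕′_ : A′ → A′ → A′) (z′ : A′)
  (_~_ : A → A′ → Set) (~-⊕ : ∀ {x y x′ y′} → x ~ x′ → y ~ y′ → (x ⊕ y) ~ (x′ ⊕′ y′)) (~-z : z ~ z′) where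
  private
    module S  = Summation _⊕_ z
    module S′ = Summation _⊕′_ z′

  Σ<-rel : ∀ n {f f′} → (∀ i → f i ~ f′ i) → S.Σ< n f ~ S′.Σ< n f′
  Σ<-rel zero    rel = ~-z
  Σ<-rel (suc n) rel = ~-⊕ (Σ<-rel n rel) (rel n)

  ΣOP-rel : ∀ B N {φ φ′} → (∀ o → φ o ~ φ′ o) → S.ΣOP B N φ ~ S′.ΣOP B N φ′
  ΣOP-rel B zero    rel = rel tt
  ΣOP-rel B (suc N) rel = ΣOP-rel B N λ o →
    ~-⊕ (Σ<-rel B λ f → rel (false , f , o)) (Σ<-rel B λ f → rel (true , f , o))

-- Finite sums and products in a commutative ring

-- Equality in an abstract ring is not decidable, so coefficients are computed in ℤ and enter
-- through the canonical map `⟦_⟧`.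
module IntegerSolver (R : CommutativeRing 0ℓ 0ℓ) where
  open CommutativeRing R
  open import Algebra.Properties.Semiring.Mult.TCOptimised semiring using (×-homo-+; ×1-homo-*; 1+×)
      renaming (_×_ to _×′_)
  open import Algebra.Properties.Ring ring
  open import Relation.Binary.Reasoning.Setoid setoid

  ⟦_⟧ : ℤ → Carrier
  ⟦ + n ⟧ = n ×′ 1#
  ⟦ -[1+ n ] ⟧ = - (suc n ×′ 1#)

  ⟦⟧-⊖ : ∀ m n → ⟦ m ℤ.⊖ n ⟧ ≈ m ×′ 1# - n ×′ 1#
  ⟦⟧-⊖ m zero = sym (trans (+-congˡ -0#≈0#) (+-identityʳ _))
  ⟦⟧-⊖ zero (suc n) = sym (+-identityˡ _)
  ⟦⟧-⊖ (suc m) (suc n) = begin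
    ⟦ suc m ℤ.⊖ suc n ⟧                  ≡⟨ ≡.cong ⟦_⟧ (ℤ.[1+m]⊖[1+n]≡m⊖n m n) ⟩
    ⟦ m ℤ.⊖ n ⟧                          ≈⟨ ⟦⟧-⊖ m n ⟩
    m ×′ 1# - n ×′ 1#                       ≈⟨ +-congʳ (xyx⁻¹≈y 1# (m ×′ 1#)) ⟨
    (1# + m ×′ 1# - 1#) - n ×′ 1#           ≈⟨ +-assoc _ _ _ ⟩
    (1# + m ×′ 1#) + (- 1# - n ×′ 1#)       ≈⟨ +-congˡ (-‿+-comm 1# (n ×′ 1#)) ⟩
    (1# + m ×′ 1#) - (1# + n ×′ 1#)         ≈⟨ +-cong (1+× m 1#) (-‿cong (1+× n 1#)) ⟨
    suc m ×′ 1# - suc n ×′ 1#               ∎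

  ⟦⟧-neg : ∀ i → ⟦ ℤ.- i ⟧ ≈ - ⟦ i ⟧
  ⟦⟧-neg (+ zero)   = sym -0#≈0#
  ⟦⟧-neg (+ suc n)  = refl
  ⟦⟧-neg -[1+ n ]   = sym (-‿involutive _)

  ⟦⟧-+ : ∀ i j → ⟦ i ℤ.+ j ⟧ ≈ ⟦ i ⟧ + ⟦ j ⟧
  ⟦⟧-+ (+ m) (+ n) = ×-homo-+ 1# m n
  ⟦⟧-+ (+ m) -[1+ n ] = ⟦⟧-⊖ m (suc n)
  ⟦⟧-+ -[1+ m ] (+ n) = trans (⟦⟧-⊖ n (suc m)) (+-comm _ _)
  ⟦⟧-+ -[1+ m ] -[1+ n ] = begin
    - (suc (suc (m ℕ.+ n)) ×′ 1#)         ≡⟨ ≡.cong (λ k → - (suc k ×′ 1#)) (ℕ.+-suc m n) ⟨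
    - ((suc m ℕ.+ suc n) ×′ 1#)           ≈⟨ -‿cong (×-homo-+ 1# (suc m) (suc n)) ⟩
    - (suc m ×′ 1# + suc n ×′ 1#)          ≈⟨ -‿+-comm _ _ ⟨
    - (suc m ×′ 1#) - suc n ×′ 1#          ∎

  ⟦⟧-*⁺ : ∀ m j → ⟦ + m ℤ.* j ⟧ ≈ ⟦ + m ⟧ * ⟦ j ⟧
  ⟦⟧-*⁺ m (+ n) = trans (reflexive (≡.cong ⟦_⟧ (≡.sym (ℤ.pos-* m n)))) (×1-homo-* m n)
  ⟦⟧-*⁺ m -[1+ n ] = begin
    ⟦ + m ℤ.* ℤ.- (+ suc n) ⟧      ≡⟨ ≡.cong ⟦_⟧ (≡.sym (ℤ.neg-distribʳ-* (+ m) (+ suc n))) ⟩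
    ⟦ ℤ.- (+ m ℤ.* + suc n) ⟧      ≈⟨ ⟦⟧-neg (+ m ℤ.* + suc n) ⟩
    - ⟦ + m ℤ.* + suc n ⟧          ≈⟨ -‿cong (⟦⟧-*⁺ m (+ suc n)) ⟩
    - (⟦ + m ⟧ * ⟦ + suc n ⟧)      ≈⟨ -‿distribʳ-* _ _ ⟩
    ⟦ + m ⟧ * - ⟦ + suc n ⟧        ∎

  ⟦⟧-* : ∀ i j → ⟦ i ℤ.* j ⟧ ≈ ⟦ i ⟧ * ⟦ j ⟧
  ⟦⟧-* (+ m) j = ⟦⟧-*⁺ m j
  ⟦⟧-* -[1+ m ] j = begin
    ⟦ ℤ.- (+ suc m) ℤ.* j ⟧        ≡⟨ ≡.cong ⟦_⟧ (≡.sym (ℤ.neg-distribˡ-* (+ suc m) j)) ⟩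
    ⟦ ℤ.- (+ suc m ℤ.* j) ⟧        ≈⟨ ⟦⟧-neg (+ suc m ℤ.* j) ⟩
    - ⟦ + suc m ℤ.* j ⟧            ≈⟨ -‿cong (⟦⟧-*⁺ (suc m) j) ⟩
    - (⟦ + suc m ⟧ * ⟦ j ⟧)        ≈⟨ -‿distribˡ-* _ _ ⟩
    - ⟦ + suc m ⟧ * ⟦ j ⟧          ∎

  morphism : ℤ.+-*-rawRing -Raw-AlmostCommutative⟶ fromCommutativeRing R
  morphism = record
    { ⟦_⟧ = ⟦_⟧ ; +-homo = ⟦⟧-+ ; *-homo = ⟦⟧-* ; -‿homo = ⟦⟧-neg ; 0-homo = refl ; 1-homo = refl }

  open Algebra.Solver.Ring ℤ.+-*-rawRing (fromCommutativeRing R) morphism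
    (λ i j → Maybe.map (λ eq → reflexive (≡.cong ⟦_⟧ eq)) (dec⇒maybe (i ℤ.≟ j))) public
    using (solve; _:=_; _:+_; _:*_; _:-_; :-_; con; _:^_)

module Sums (R : CommutativeRing 0ℓ 0ℓ) where
  open CommutativeRing R hiding (zero)
  open IntegerSolver R
  open import Relation.Binary.Reasoning.Setoid setoid

  open Summation _+_ 0# public

  Π< : ℕ → (ℕ → Carrier) → Carrier
  Π< zero    f = 1#
  Π< (suc n) f = Π< n f * f n

  Σ<-first : ∀ n f → Σ< (suc n) f ≈ f 0 + Σ< n (λ i → f (suc i))
  Σ<-first zero    f = +-comm _ _
  Σ<-first (suc n) f = trans (+-congʳ (Σ<-first n f)) (+-assoc _ _ _)

  open SummationRel _+_ 0# _+_ 0# _≈_ +-cong refl public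
    renaming (Σ<-rel to Σ<-cong; ΣOP-rel to ΣOP-cong)

  Σ<-zero : ∀ n {f} → (∀ i → f i ≈ 0#) → Σ< n f ≈ 0#
  Σ<-zero zero    f≈0 = refl
  Σ<-zero (suc n) f≈0 = trans (+-cong (Σ<-zero n f≈0) (f≈0 n)) (+-identityˡ 0#)

  Σ<-+ : ∀ n f g → Σ< n (λ i → f i + g i) ≈ Σ< n f + Σ< n g
  Σ<-+ zero    f g = sym (+-identityˡ 0#)
  Σ<-+ (suc n) f g = trans (+-congʳ (Σ<-+ n f g))
    (solve 4 (λ a b c d → (a :+ b) :+ (c :+ d) := (a :+ c) :+ (b :+ d)) refl _ _ _ _)

  Σ<-*ˡ : ∀ n c f → Σ< n (λ i → c * f i) ≈ c * Σ< n f
  Σ<-*ˡ zero    c f = sym (zeroʳ c)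
  Σ<-*ˡ (suc n) c f = trans (+-congʳ (Σ<-*ˡ n c f)) (sym (distribˡ c _ _))

  ΣOP-*ʳ : ∀ B N c φ → ΣOP B N (λ o → φ o * c) ≈ ΣOP B N φ * c
  ΣOP-*ʳ B N c φ = SummationRel.ΣOP-rel _+_ 0# _+_ 0# (λ x y → x ≈ y * c)
    (λ p q → trans (+-cong p q) (sym (distribʳ c _ _))) (sym (zeroˡ c)) B N (λ o → refl)

  -- Two series can agree only after reindexing part of one of them by one; `g` is the part that is
  -- moved, and it must vanish at both ends.
  Σ<-telescope : ∀ n {f f′} (g : ℕ → Carrier) → (∀ i → f i ≈ f′ i + (g i - g (suc i))) →
                 g 0 ≈ 0# → g n ≈ 0# → Σ< n f ≈ Σ< n f′
  Σ<-telescope n {f} {f′} g step g₀ gₙ = begin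
    Σ< n f                    ≈⟨ go n ⟩
    Σ< n f′ + (g 0 - g n)     ≈⟨ +-congˡ (+-cong g₀ (-‿cong gₙ)) ⟩
    Σ< n f′ + (0# - 0#)       ≈⟨ +-congˡ (-‿inverseʳ 0#) ⟩
    Σ< n f′ + 0#              ≈⟨ +-identityʳ _ ⟩
    Σ< n f′                   ∎
    where
    go : ∀ n → Σ< n f ≈ Σ< n f′ + (g 0 - g n)
    go zero    = solve 1 (λ x → con (+ 0) := con (+ 0) :+ (x :- x)) refl (g 0)
    go (suc n) = trans (+-cong (go n) (step n))
      (solve 5 (λ a b c d e → (a :+ (b :- c)) :+ (d :+ (c :- e))
          := (a :+ d) :+ (b :- e)) refl (Σ< n f′) (g 0) (g n) (f′ n) (g (suc n)))

  Π<-cong : ∀ n {f g} → (∀ i → f i ≈ g i) → Π< n f ≈ Π< n g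
  Π<-cong zero    f≈g = refl
  Π<-cong (suc n) f≈g = *-cong (Π<-cong n f≈g) (f≈g n)

  Π<-* : ∀ n f g → Π< n (λ i → f i * g i) ≈ Π< n f * Π< n g
  Π<-* zero    f g = sym (*-identityˡ 1#)
  Π<-* (suc n) f g = trans (*-congʳ (Π<-* n f g))
    (solve 4 (λ a b c d → (a :* b) :* (c :* d) := (a :* c) :* (b :* d)) refl _ _ _ _)

  Π<-first : ∀ n f → Π< (suc n) f ≈ f 0 * Π< n (λ i → f (suc i))
  Π<-first zero    f = *-comm _ _
  Π<-first (suc n) f = trans (*-congʳ (Π<-first n f)) (*-assoc _ _ _)

  Π<-first-at : ∀ n (f : ℕ → Carrier) k →
    Π< (suc n) (λ i → f (k ℕ.+ i)) ≈ f k * Π< n (λ i → f (suc k ℕ.+ i))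
  Π<-first-at n f k = trans (Π<-first n (λ i → f (k ℕ.+ i))) (*-cong
    (reflexive (≡.cong f (ℕ.+-identityʳ k))) (Π<-cong n (λ i → reflexive (≡.cong f (ℕ.+-suc k i)))))

  -- A product of n factors stands for an infinite one: the factor gained at the far end is 1, so
  -- peeling off the first factor keeps the length.
  Π<-shift : ∀ n (f : ℕ → Carrier) k → f (k ℕ.+ n) ≈ 1# →
    Π< n (λ i → f (k ℕ.+ i)) ≈ f k * Π< n (λ i → f (suc k ℕ.+ i))
  Π<-shift n f k last≈1 =
    trans (sym (trans (*-congˡ last≈1) (*-identityʳ _))) (Π<-first-at n f k)

  Π<-tail : ∀ n d f → (∀ i → n ≤ i → f i ≈ 1#) → Π< (d ℕ.+ n) f ≈ Π< n f
  Π<-tail n zero    f tail = refl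
  Π<-tail n (suc d) f tail =
    trans (*-cong (Π<-tail n d f tail) (tail (d ℕ.+ n) (ℕ.m≤n+m n d))) (*-identityʳ _)

  Π<-one : ∀ n f → (∀ i → f i ≈ 1#) → Π< n f ≈ 1#
  Π<-one zero    f f≈1 = refl
  Π<-one (suc n) f f≈1 = trans (*-cong (Π<-one n f f≈1) (f≈1 n)) (*-identityʳ 1#)

  -- The sum over i + j = L, with both indices passed on so that no subtraction occurs.
  conv : (ℕ → ℕ → Carrier) → ℕ → Carrier
  conv f zero    = f 0 0
  conv f (suc L) = f 0 (suc L) + conv (λ i j → f (suc i) j) L

  conv-last : ∀ f L → conv f (suc L) ≈ conv (λ i j → f i (suc j)) L + f (suc L) 0
  conv-last f zero    = refl
  conv-last f (suc L) = trans (+-congˡ (conv-last (λ i j → f (suc i) j) L)) (sym (+-assoc _ _ _))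

  conv-cong : ∀ L {f g} → (∀ i j → i ℕ.+ j ≡ L → f i j ≈ g i j) → conv f L ≈ conv g L
  conv-cong zero    f≈g = f≈g 0 0 ≡.refl
  conv-cong (suc L) f≈g =
    +-cong (f≈g 0 (suc L) ≡.refl) (conv-cong L (λ i j eq → f≈g (suc i) j (≡.cong suc eq)))

  conv-+ : ∀ L f g → conv (λ i j → f i j + g i j) L ≈ conv f L + conv g L
  conv-+ zero    f g = refl
  conv-+ (suc L) f g = trans (+-congˡ (conv-+ L _ _))
    (solve 4 (λ a b c d → (a :+ b) :+ (c :+ d) := (a :+ c) :+ (b :+ d)) refl _ _ _ _)

  conv-*ˡ : ∀ L c f → conv (λ i j → c * f i j) L ≈ c * conv f L
  conv-*ˡ zero    c f = refl
  conv-*ˡ (suc L) c f = trans (+-congˡ (conv-*ˡ L c _)) (sym (distribˡ c _ _))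

-- Jacobi's triple product in finite form

n*2≡n+n : ∀ n → n ℕ.* 2 ≡ n ℕ.+ n
n*2≡n+n n = ≡.trans (ℕ.*-comm n 2) (≡.cong (n ℕ.+_) (ℕ.+-identityʳ n))

1+n*2≡n+[1+n] : ∀ n → suc (n ℕ.* 2) ≡ n ℕ.+ suc n
1+n*2≡n+[1+n] n = ≡.trans (≡.cong suc (n*2≡n+n n)) (≡.sym (ℕ.+-suc n n))

module TripleProduct (R : CommutativeRing 0ℓ 0ℓ) where
  open CommutativeRing R hiding (zero)
  open IntegerSolver R
  open Sums R
  open import Algebra.Properties.Semiring.Exp semiring
  open import Relation.Binary.Reasoning.Setoid setoid

  -- `u k` plays the role of the tail (1 - Q^(k+1)) (1 - Q^(k+2)) ⋯ with Q = a b, which has no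
  -- meaning in a general ring; its recurrence is enough.
  module _ (a b : Carrier) (u : ℕ → Carrier)
           (u-step : ∀ k → u k ≈ (1# - (a * b) ^ suc k) * u (suc k)) where

    Q : Carrier
    Q = a * b

    -- `half c k` is (-1)^k c^k Q^(k(k-1)/2). Using one half series in a and one in b avoids an
    -- inverse of a.
    half : Carrier → ℕ → Carrier
    half c zero    = 1#
    half c (suc k) = - (c * Q ^ k * half c k)

    -- The coefficient w n k is (-1)^j a^j Q^(j(j-1)/2) for j = k - n, where a^(-1) Q = b.
    w : ℕ → ℕ → Carrier
    w zero    k       = half a k
    w (suc n) zero    = half b (suc n)
    w (suc n) (suc k) = w n k

    w-zero : ∀ n → w n 0 ≈ half b n
    w-zero zero    = refl
    w-zero (suc n) = refl

    -- The ratio of neighbouring coefficients is -a Q^(i-n); the factor Q^j, with i + j = m + n,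
    -- keeps the exponent natural.
    w-sucʳ : ∀ n m i j → i ℕ.+ j ≡ m ℕ.+ n → w n (suc i) * Q ^ j ≈ - (a * Q ^ m) * w n i
    w-sucʳ zero m i j eq = begin
      - (a * Q ^ i * h) * Q ^ j
        ≈⟨ solve 4 (λ A I H J → :- (A :* I :* H) :* J := :- (A :* (I :* J)) :* H) refl a (Q ^ i) h (Q ^ j) ⟩
      - (a * (Q ^ i * Q ^ j)) * h  ≈⟨ *-congʳ (-‿cong (*-congˡ (^-homo-* Q i j))) ⟨
      - (a * Q ^ (i ℕ.+ j)) * h    ≡⟨ ≡.cong (λ e → - (a * Q ^ e) * h) (≡.trans eq (ℕ.+-identityʳ m)) ⟩
      - (a * Q ^ m) * h            ∎
      where h = half a i
    w-sucʳ (suc n) m zero j eq = begin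
      w n 0 * Q ^ j                           ≈⟨ *-congʳ (w-zero n) ⟩
      half b n * Q ^ j                        ≡⟨ ≡.cong (λ e → half b n * Q ^ e) (≡.trans eq (ℕ.+-suc m n)) ⟩
      half b n * (Q * Q ^ (m ℕ.+ n))          ≈⟨ *-congˡ (*-congˡ (^-homo-* Q m n)) ⟩
      half b n * (a * b * (Q ^ m * Q ^ n))
        ≈⟨ solve 5 (λ A B H M N → H :* (A :* B :* (M :* N))
            := :- (A :* M) :* (:- (B :* N :* H))) refl a b (half b n) (Q ^ m) (Q ^ n) ⟩
      - (a * Q ^ m) * - (b * Q ^ n * half b n) ∎
    w-sucʳ (suc n) m (suc i) j eq =
      w-sucʳ n m i j (ℕ.suc-injective (≡.trans eq (ℕ.+-suc m n)))

    w-sucˡ : ∀ n i → w (suc n) i * Q ^ i ≈ - (b * Q ^ n) * w n i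
    w-sucˡ n zero = trans (*-identityʳ _) (trans
      (solve 3 (λ B N H → :- (B :* N :* H) := :- (B :* N) :* H) refl b (Q ^ n) (half b n))
      (*-congˡ (sym (w-zero n))))
    w-sucˡ zero (suc i) = solve 4 (λ A B I H → H :* (A :* B :* I) := :- (B :* con (+ 1)) :* :- (A :* I :* H))
      refl a b (Q ^ i) (half a i)
    w-sucˡ (suc n) (suc i) = begin
      w (suc n) i * (Q * Q ^ i)      ≈⟨ solve 3 (λ W q I → W :* (q :* I) := q :* (W :* I)) refl _ Q (Q ^ i) ⟩
      Q * (w (suc n) i * Q ^ i)      ≈⟨ *-congˡ (w-sucˡ n i) ⟩
      Q * (- (b * Q ^ n) * w n i)
        ≈⟨ solve 4 (λ q B N W → q :* (:- (B :* N) :* W) := :- (B :* (q :* N)) :* W) refl Q b (Q ^ n) _ ⟩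
      - (b * (Q * Q ^ n)) * w n i    ∎

    -- Since `u i * u j` stands for (Q)_∞² / ((Q)_i (Q)_j), this is, up to (Q)_∞² / (Q)_L, the sum
    -- of Gaussian binomials [L, i] times `w n i`.
    Y : ℕ → ℕ → Carrier
    Y n L = conv (λ i j → w n i * (u i * u j)) L

    private
      -- The origin of the q-Pascal rules: each of 1 - Q^i and 1 - Q^j lowers one index through
      -- `u-step`. Exchanging i and j gives the second rule.
      split : ∀ L i j → i ℕ.+ j ≡ suc L → 1# - Q ^ suc L ≈ (1# - Q ^ i) + Q ^ i * (1# - Q ^ j)
      split L i j eq = begin
        1# - Q ^ suc L        ≡⟨ ≡.cong (λ e → 1# - Q ^ e) (≡.sym eq) ⟩
        1# - Q ^ (i ℕ.+ j)    ≈⟨ +-congˡ (-‿cong (^-homo-* Q i j)) ⟩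
        1# - Q ^ i * Q ^ j
          ≈⟨ solve 2 (λ I J → con (+ 1) :- I :* J := (con (+ 1) :- I) :+ I :* (con (+ 1) :- J)) refl (Q ^ i) (Q ^ j) ⟩
        (1# - Q ^ i) + Q ^ i * (1# - Q ^ j) ∎

      dropˡ : ∀ L (g : ℕ → ℕ → Carrier) →
              conv (λ i j → g i j * ((1# - Q ^ i) * u i * u j)) (suc L) ≈ conv (λ i j → g (suc i) j * (u i * u j)) L
      dropˡ L g = trans (+-cong
        (solve 3 (λ g x y → g :* ((con (+ 1) :- con (+ 1)) :* x :* y) := con (+ 0)) refl _ _ _)
        (conv-cong L (λ i j _ → *-congˡ (*-congʳ (sym (u-step i))))))
        (+-identityˡ _)

      dropʳ : ∀ L (g : ℕ → ℕ → Carrier) →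
              conv (λ i j → g i j * (u i * ((1# - Q ^ j) * u j))) (suc L) ≈ conv (λ i j → g i (suc j) * (u i * u j)) L
      dropʳ L g = trans (conv-last (λ i j → g i j * (u i * ((1# - Q ^ j) * u j))) L) (trans (+-cong
        (conv-cong L (λ i j _ → *-congˡ (*-congˡ (sym (u-step j)))))
        (solve 3 (λ g x y → g :* (x :* ((con (+ 1) :- con (+ 1)) :* y))
            := con (+ 0)) refl (g (suc L) 0) (u (suc L)) (u 0)))
        (+-identityʳ _))

    -- Lowering i turns `w (suc n)` into `w n`, so the summand with 1 - Q^i gives `Y n L`; `w-sucˡ`
    -- makes the other one -b Q^n times the same sum.
    Y-stepˡ : ∀ n L → (1# - Q ^ suc L) * Y (suc n) (suc L) ≈ (1# - b * Q ^ n) * Y n L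
    Y-stepˡ n L = begin
      (1# - Q ^ suc L) * Y (suc n) (suc L)
        ≈⟨ conv-*ˡ (suc L) (1# - Q ^ suc L) (λ i j → w (suc n) i * (u i * u j)) ⟨
      conv (λ i j → (1# - Q ^ suc L) * (w (suc n) i * (u i * u j))) (suc L)
        ≈⟨ conv-cong (suc L) (λ i j eq → trans (*-congʳ (split L i j eq))
             (solve 5 (λ W I J x y → ((con (+ 1) :- I) :+ I :* (con (+ 1) :- J)) :* (W :* (x :* y))
                := W :* ((con (+ 1) :- I) :* x :* y) :+ (W :* I) :* (x :* ((con (+ 1) :- J) :* y)))
                  refl (w (suc n) i) (Q ^ i) (Q ^ j) (u i) (u j))) ⟩
      conv (λ i j → w (suc n) i * ((1# - Q ^ i) * u i * u j) + (w (suc n) i * Q ^ i) * (u i * ((1# - Q ^ j) * u j))) (suc L)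
        ≈⟨ trans (conv-+ (suc L) (λ i j → w (suc n) i * ((1# - Q ^ i) * u i * u j))
             (λ i j → (w (suc n) i * Q ^ i) * (u i * ((1# - Q ^ j) * u j))))
                 (+-cong (dropˡ L (λ i _ → w (suc n) i)) (dropʳ L (λ i _ → w (suc n) i * Q ^ i))) ⟩
      Y n L + conv (λ i j → (w (suc n) i * Q ^ i) * (u i * u j)) L
        ≈⟨ +-congˡ (trans (conv-cong L (λ i j _ → trans (*-congʳ (w-sucˡ n i)) (*-assoc _ _ _))) (conv-*ˡ L _ _)) ⟩
      Y n L + - (b * Q ^ n) * Y n L
        ≈⟨ solve 2 (λ y c → y :+ :- c :* y := (con (+ 1) :- c) :* y) refl _ _ ⟩
      (1# - b * Q ^ n) * Y n L ∎

    -- The mirrored splitting keeps the centre n; the condition L = m + n makes the extra factor -a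
    -- Q^m the same for all i.
    Y-stepʳ : ∀ m n L → L ≡ m ℕ.+ n → (1# - Q ^ suc L) * Y n (suc L) ≈ (1# - a * Q ^ m) * Y n L
    Y-stepʳ m n L L≡m+n = begin
      (1# - Q ^ suc L) * Y n (suc L)
        ≈⟨ conv-*ˡ (suc L) (1# - Q ^ suc L) (λ i j → w n i * (u i * u j)) ⟨
      conv (λ i j → (1# - Q ^ suc L) * (w n i * (u i * u j))) (suc L)
        ≈⟨ conv-cong (suc L) (λ i j eq → trans (*-congʳ (split L j i (≡.trans (ℕ.+-comm j i) eq)))
             (solve 5 (λ W I J x y → ((con (+ 1) :- J) :+ J :* (con (+ 1) :- I)) :* (W :* (x :* y))
                := W :* (x :* ((con (+ 1) :- J) :* y)) :+ (W :* J) :* ((con (+ 1) :- I) :* x :* y))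
                  refl (w n i) (Q ^ i) (Q ^ j) (u i) (u j))) ⟩
      conv (λ i j → w n i * (u i * ((1# - Q ^ j) * u j)) + (w n i * Q ^ j) * ((1# - Q ^ i) * u i * u j)) (suc L)
        ≈⟨ trans (conv-+ (suc L) (λ i j → w n i * (u i * ((1# - Q ^ j) * u j)))
             (λ i j → (w n i * Q ^ j) * ((1# - Q ^ i) * u i * u j)))
                 (+-cong (dropʳ L (λ i _ → w n i)) (dropˡ L (λ i j → w n i * Q ^ j))) ⟩
      Y n L + conv (λ i j → (w n (suc i) * Q ^ j) * (u i * u j)) L
        ≈⟨ +-congˡ (trans
             (conv-cong L (λ i j eq → trans (*-congʳ (w-sucʳ n m i j (≡.trans eq L≡m+n))) (*-assoc _ _ _)))
             (conv-*ˡ L _ _)) ⟩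
      Y n L + - (a * Q ^ m) * Y n L
        ≈⟨ solve 2 (λ y c → y :+ :- c :* y := (con (+ 1) :- c) :* y) refl _ _ ⟩
      (1# - a * Q ^ m) * Y n L ∎

    -- Passing to M + 1 raises L by two, once by each q-Pascal rule, which contributes one factor
    -- with a and one with b.
    finiteTripleProduct : ∀ M →
      Π< (M ℕ.* 2) (λ i → 1# - Q ^ suc i) * Y M (M ℕ.* 2)
        ≈ Π< M (λ i → (1# - a * Q ^ i) * (1# - b * Q ^ i)) * (u 0 * u 0)
    finiteTripleProduct zero = *-congˡ (*-identityˡ _)
    finiteTripleProduct (suc M) = begin
      (p * x) * y * Y (suc M) (suc (suc (M ℕ.* 2)))
        ≈⟨ *-assoc _ _ _ ⟩
      (p * x) * (y * Y (suc M) (suc (suc (M ℕ.* 2))))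
        ≈⟨ *-congˡ (Y-stepʳ M (suc M) (suc (M ℕ.* 2)) (1+n*2≡n+[1+n] M)) ⟩
      (p * x) * ((1# - a * Q ^ M) * Y (suc M) (suc (M ℕ.* 2)))
        ≈⟨ solve 4 (λ p x α z → (p :* x) :* (α :* z) := (p :* α) :* (x :* z)) refl _ _ _ _ ⟩
      (p * (1# - a * Q ^ M)) * (x * Y (suc M) (suc (M ℕ.* 2)))
        ≈⟨ *-congˡ (Y-stepˡ M (M ℕ.* 2)) ⟩
      (p * (1# - a * Q ^ M)) * ((1# - b * Q ^ M) * Y M (M ℕ.* 2))
        ≈⟨ solve 4 (λ p α β z → (p :* α) :* (β :* z) := (p :* z) :* (α :* β)) refl _ _ _ _ ⟩
      (p * Y M (M ℕ.* 2)) * ((1# - a * Q ^ M) * (1# - b * Q ^ M))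
        ≈⟨ *-congʳ (finiteTripleProduct M) ⟩
      (_ * (u 0 * u 0)) * ((1# - a * Q ^ M) * (1# - b * Q ^ M))
        ≈⟨ solve 3 (λ r z c → (r :* z) :* c := (r :* c) :* z) refl _ _ _ ⟩
      (_ * ((1# - a * Q ^ M) * (1# - b * Q ^ M))) * (u 0 * u 0) ∎
      where
      p = Π< (M ℕ.* 2) (λ i → 1# - Q ^ suc i)
      x = 1# - Q ^ suc (M ℕ.* 2)
      y = 1# - Q ^ suc (suc (M ℕ.* 2))

    w-below : ∀ i d → w (i ℕ.+ d) i ≈ half b d
    w-below zero    d = w-zero d
    w-below (suc i) d = w-below i d

    w-above : ∀ n d → w n (n ℕ.+ d) ≈ half a d
    w-above zero    d = refl
    w-above (suc n) d = w-above n d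

    -- The theta terms j = -n and j = n + 1 are paired, as in the Rogers-Ramanujan series at N = 0;
    -- j = -M remains over.
    w-sum : ∀ M → conv (λ i _ → w M i) (M ℕ.* 2) ≈ Σ< M (λ n → half b n + half a (suc n)) + half b M
    w-sum zero    = sym (+-identityˡ 1#)
    w-sum (suc M) = begin
      half b (suc M) + conv (λ i _ → w M i) (suc (M ℕ.* 2))
        ≈⟨ +-congˡ (trans (conv-last (λ i _ → w M i) (M ℕ.* 2)) (+-cong (w-sum M) last)) ⟩
      half b (suc M) + ((Σ< M _ + half b M) + half a (suc M))
        ≈⟨ solve 4 (λ x s y z → x :+ ((s :+ y) :+ z) := (s :+ (y :+ z)) :+ x) refl _ _ _ _ ⟩
      (Σ< M _ + (half b M + half a (suc M))) + half b (suc M) ∎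
      where
      last : w M (suc (M ℕ.* 2)) ≈ half a (suc M)
      last = trans (reflexive (≡.cong (w M) (1+n*2≡n+[1+n] M))) (w-above M (suc M))

-- The Rogers–Ramanujan series modulo a power of q

module Nilpotent
  (R : CommutativeRing 0ℓ 0ℓ) (q : CommutativeRing.Carrier R) (K : ℕ)
  (q^K≈0 : CommutativeRing._≈_ R (Exp._^_ (CommutativeRing.semiring R) q K) (CommutativeRing.0# R)) where
  open CommutativeRing R hiding (zero)
  open Exp semiring
  open IntegerSolver R
  open Sums R
  open import Algebra.Properties.Ring ring using (x∙y⁻¹≈ε⇒x≈y)
  open import Relation.Binary.Reasoning.Setoid setoid

  q^≈0 : ∀ {m} → K ≤ m → q ^ m ≈ 0#
  q^≈0 {m} K≤m = begin
    q ^ m                     ≡⟨ ≡.cong (q ^_) (ℕ.m+[n∸m]≡n K≤m) ⟨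
    q ^ (K ℕ.+ (m ∸ K))       ≈⟨ ^-homo-* q K (m ∸ K) ⟩
    q ^ K * q ^ (m ∸ K)       ≈⟨ *-congʳ q^K≈0 ⟩
    0# * q ^ (m ∸ K)          ≈⟨ zeroˡ _ ⟩
    0#                        ∎

  1-q^≈1 : ∀ {m} → K ≤ m → 1# - q ^ m ≈ 1#
  1-q^≈1 K≤m = trans (+-congˡ (-‿cong (q^≈0 K≤m))) (solve 0 (con (+ 1) :- con (+ 0) := con (+ 1)) refl)

  1+q^≈1 : ∀ {m} → K ≤ m → 1# + q ^ m ≈ 1#
  1+q^≈1 K≤m = trans (+-congˡ (q^≈0 K≤m)) (+-identityʳ 1#)

  -- After K iterations the factor in front of x is a power of q with exponent at least K.
  -- Cancelling 1 - q^(m+1) rests on this, without any inverse.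
  fixed⇒0 : ∀ m x → x ≈ q ^ suc m * x → x ≈ 0#
  fixed⇒0 m x x≈qx = begin
    x               ≈⟨ iterate K ⟩
    (q ^ suc m) ^ K * x ≈⟨ *-congʳ (trans (^-assocʳ q (suc m) K) (q^≈0 (ℕ.m≤m+n K (m ℕ.* K)))) ⟩
    0# * x          ≈⟨ zeroˡ x ⟩
    0#              ∎
    where
    iterate : ∀ j → x ≈ (q ^ suc m) ^ j * x
    iterate zero    = sym (*-identityˡ x)
    iterate (suc j) = trans x≈qx (trans (*-congˡ (iterate j)) (sym (*-assoc _ _ _)))

  1-q^-cancelˡ : ∀ m x y → (1# - q ^ suc m) * x ≈ (1# - q ^ suc m) * y → x ≈ y
  1-q^-cancelˡ m x y eq = x∙y⁻¹≈ε⇒x≈y x y (fixed⇒0 m (x - y) (begin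
    x - y
      ≈⟨ solve 3 (λ x y z → x :- y
          := ((con (+ 1) :- z) :* x :- (con (+ 1) :- z) :* y) :+ z :* (x :- y)) refl x y (q ^ suc m) ⟩
    ((1# - q ^ suc m) * x - (1# - q ^ suc m) * y) + q ^ suc m * (x - y)
      ≈⟨ +-congʳ (trans (+-congʳ eq) (-‿inverseʳ _)) ⟩
    0# + q ^ suc m * (x - y)
      ≈⟨ +-identityˡ _ ⟩
    q ^ suc m * (x - y) ∎))

  Π1-q^-cancelˡ : ∀ n (e : ℕ → ℕ) x y →
    Π< n (λ i → 1# - q ^ suc (e i)) * x ≈ Π< n (λ i → 1# - q ^ suc (e i)) * y → x ≈ y
  Π1-q^-cancelˡ zero    e x y eq = trans (sym (*-identityˡ x)) (trans eq (*-identityˡ y))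
  Π1-q^-cancelˡ (suc n) e x y eq = 1-q^-cancelˡ (e n) x y (Π1-q^-cancelˡ n e _ _
    (trans (sym (*-assoc _ _ _)) (trans eq (*-assoc _ _ _))))

  -- The quotient (q)_(n+N) / (q)_n, written without division.
  poch : ℕ → ℕ → Carrier
  poch n N = Π< N (λ i → 1# - q ^ suc (n ℕ.+ i))

  poch-first : ∀ n N → (1# - q ^ suc n) * poch (suc n) N ≈ poch n (suc N)
  poch-first n N = sym (Π<-first-at N (λ i → 1# - q ^ suc i) n)

  poch-last : ∀ n N → poch n (suc N) ≈ poch n N * (1# - q * (q ^ n * q ^ N))
  poch-last n N = *-congˡ (+-congˡ (-‿cong (*-congˡ (^-homo-* q n N))))

  -- This is (-1)^n q^(2Nn + n(5n+1)/2), given by successive ratios to avoid the halved exponent.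
  t : ℕ → ℕ → Carrier
  t N zero    = 1#
  t N (suc n) = - ((q ^ N) ^ 2 * (q ^ n) ^ 5 * q ^ 3 * t N n)

  t-suc : ∀ N n → t (suc N) n ≈ (q ^ n) ^ 2 * t N n
  t-suc N zero    = solve 0 (con (+ 1) := con (+ 1) :^ 2 :* con (+ 1)) refl
  t-suc N (suc n) = begin
    - ((q * X) ^ 2 * Y ^ 5 * q ^ 3 * t (suc N) n)     ≈⟨ -‿cong (*-congˡ (t-suc N n)) ⟩
    - ((q * X) ^ 2 * Y ^ 5 * q ^ 3 * (Y ^ 2 * t N n))
      ≈⟨ solve 4 (λ q X Y t → :- ((q :* X) :^ 2 :* Y :^ 5 :* q :^ 3 :* (Y :^ 2 :* t))
                    := (q :* Y) :^ 2 :* :- (X :^ 2 :* Y :^ 5 :* q :^ 3 :* t)) refl q X Y (t N n) ⟩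
    (q * Y) ^ 2 * - (X ^ 2 * Y ^ 5 * q ^ 3 * t N n)   ∎
    where
    X = q ^ N
    Y = q ^ n

  -- Summed over n, these are (q)_∞ J_{2,2}(x) and (q)_∞ J_{2,1}(x) at x = q ^ N, the two functions of the classical
  -- q-difference system J_{2,1}(x) = J_{2,2}(xq), J_{2,2}(x) = J_{2,1}(x) + xq J_{2,1}(xq).
  s : ℕ → ℕ → Carrier
  s N n = t N n * (1# - (q ^ N) ^ 2 * (q ^ n) ^ 4 * q ^ 2) * poch n N

  s′ : ℕ → ℕ → Carrier
  s′ N n = t N n * q ^ n * (1# - q ^ N * (q ^ n) ^ 2 * q) * poch n N

  module _ (N n : ℕ) where
    private
      X Y p τ E : Carrier
      X = q ^ N
      Y = q ^ n
      p = poch n N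
      τ = t N n
      E = 1# - q * (Y * X)

      boundary : (1# - q ^ suc n) * poch (suc n) N ≈ p * E
      boundary = trans (poch-first n N) (poch-last n N)

    -- Write 1 - q^(2N+4n+2) - q^n (1 - q^(N+2n+1)) as (1 - q^n) + q^(N+3n+1) (1 - q^(N+n+1)). The
    -- first piece vanishes at n = 0; moved from n to n + 1 it merges with the second into
    -- `q ^ suc N * s′ (suc N) n`.
    s-diff : s N n ≈ (s′ N n + q ^ suc N * s′ (suc N) n)
                     + (t N n * (1# - q ^ n) * poch n N - t N (suc n) * (1# - q ^ suc n) * poch (suc n) N)
    s-diff = sym (begin
      (s′ N n + q * X * (t (suc N) n * Y * (1# - q * X * Y ^ 2 * q) * poch n (suc N)))
        + (τ * (1# - Y) * p - t N (suc n) * (1# - q ^ suc n) * poch (suc n) N)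
        ≈⟨ +-cong (+-congˡ (*-congˡ (*-cong (*-congʳ (*-congʳ (t-suc N n))) (poch-last n N))))
             (+-congˡ (-‿cong (trans (*-assoc _ _ _) (*-congˡ boundary)))) ⟩
      (s′ N n + q * X * (Y ^ 2 * τ * Y * (1# - q * X * Y ^ 2 * q) * (p * E)))
        + (τ * (1# - Y) * p - t N (suc n) * (p * E))
        ≈⟨ solve 5 (λ q X Y p τ →
             (τ :* Y :* (con (+ 1) :- X :* Y :^ 2 :* q) :* p
               :+ q :* X :* (Y :^ 2 :* τ :* Y :* (con (+ 1) :- q :* X :* Y :^ 2 :* q) :* (p :* (con (+ 1) :- q :* (Y :* X)))))
             :+ (τ :* (con (+ 1) :- Y) :* p
               :- (:- (X :^ 2 :* Y :^ 5 :* q :^ 3 :* τ)) :* (p :* (con (+ 1) :- q :* (Y :* X))))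
             := τ :* (con (+ 1) :- X :^ 2 :* Y :^ 4 :* q :^ 2) :* p) refl q X Y p τ ⟩
      s N n ∎)

    -- The same device with 1 - q^(N+2n+1) = (1 - q^n) + q^n (1 - q^(N+n+1)).
    s′-diff : s′ N n ≈ s (suc N) n
                     + (t N n * q ^ n * (1# - q ^ n) * poch n N
                        - t N (suc n) * q ^ suc n * (1# - q ^ suc n) * poch (suc n) N)
    s′-diff = sym (begin
      t (suc N) n * (1# - (q * X) ^ 2 * Y ^ 4 * q ^ 2) * poch n (suc N)
        + (τ * Y * (1# - Y) * p - t N (suc n) * (q * Y) * (1# - q ^ suc n) * poch (suc n) N)
        ≈⟨ +-cong (*-cong (*-congʳ (t-suc N n)) (poch-last n N))
             (+-congˡ (-‿cong (trans (*-assoc _ _ _) (*-congˡ boundary)))) ⟩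
      Y ^ 2 * τ * (1# - (q * X) ^ 2 * Y ^ 4 * q ^ 2) * (p * E)
        + (τ * Y * (1# - Y) * p - t N (suc n) * (q * Y) * (p * E))
        ≈⟨ solve 5 (λ q X Y p τ →
             Y :^ 2 :* τ :* (con (+ 1) :- (q :* X) :^ 2 :* Y :^ 4 :* q :^ 2) :* (p :* (con (+ 1) :- q :* (Y :* X)))
             :+ (τ :* Y :* (con (+ 1) :- Y) :* p
               :- (:- (X :^ 2 :* Y :^ 5 :* q :^ 3 :* τ)) :* (q :* Y) :* (p :* (con (+ 1) :- q :* (Y :* X))))
             := τ :* Y :* (con (+ 1) :- X :* Y :^ 2 :* q) :* p) refl q X Y p τ ⟩
      s′ N n ∎)

  t-zero : ∀ N {n} → K ≤ suc n → t N (suc n) ≈ 0#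
  t-zero N {n} K≤n = begin
    - ((q ^ N) ^ 2 * (q ^ n) ^ 5 * q ^ 3 * t N n)
      ≈⟨ solve 4 (λ q X Y t → :- (X :^ 2 :* Y :^ 5 :* q :^ 3 :* t)
          := (q :* Y) :* :- (X :^ 2 :* Y :^ 4 :* q :^ 2 :* t)) refl q (q ^ N) (q ^ n) _ ⟩
    q ^ suc n * - ((q ^ N) ^ 2 * (q ^ n) ^ 4 * q ^ 2 * t N n)
      ≈⟨ trans (*-congʳ (q^≈0 K≤n)) (zeroˡ _) ⟩
    0# ∎

  t-zero-N : ∀ {N} n → K ≤ N → t N (suc n) ≈ 0#
  t-zero-N {N} n K≤N = begin
    - ((q ^ N) ^ 2 * (q ^ n) ^ 5 * q ^ 3 * t N n)
      ≈⟨ solve 4 (λ q X Y t → :- (X :^ 2 :* Y :^ 5 :* q :^ 3 :* t)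
          := X :* :- (X :* Y :^ 5 :* q :^ 3 :* t)) refl q (q ^ N) (q ^ n) _ ⟩
    q ^ N * - (q ^ N * (q ^ n) ^ 5 * q ^ 3 * t N n)
      ≈⟨ trans (*-congʳ (q^≈0 K≤N)) (zeroˡ _) ⟩
    0# ∎

  -- Summing K terms would lose nothing of the series; 2K is asked for so that every nonzero theta
  -- coefficient lies at least K away from both ends of the finite triple product.
  module Series (M-1 : ℕ) (K+K≤M : K ℕ.+ K ≤ suc M-1) where
    M : ℕ
    M = suc M-1

    K≤M : K ≤ M
    K≤M = ℕ.≤-trans (ℕ.m≤m+n K K) K+K≤M

    S S′ : ℕ → Carrier
    S  N = Σ< M (s N)
    S′ N = Σ< M (s′ N)

    S′≈S : ∀ N → S′ N ≈ S (suc N)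
    S′≈S N = Σ<-telescope M (λ n → t N n * q ^ n * (1# - q ^ n) * poch n N) (s′-diff N)
      (solve 1 (λ p → con (+ 1) :* con (+ 1) :* (con (+ 1) :- con (+ 1)) :* p := con (+ 0)) refl (poch 0 N))
      (trans (*-congʳ (*-congʳ (*-congʳ (t-zero N K≤M))))
        (solve 3 (λ x y z → con (+ 0) :* x :* y :* z := con (+ 0)) refl (q ^ M) (1# - q ^ M) (poch M N)))

    S-rec : ∀ N → S N ≈ S (suc N) + q ^ suc N * S (suc (suc N))
    S-rec N = begin
      S N
        ≈⟨ Σ<-telescope M (λ n → t N n * (1# - q ^ n) * poch n N) (s-diff N)
             (solve 1 (λ p → con (+ 1) :* (con (+ 1) :- con (+ 1)) :* p := con (+ 0)) refl (poch 0 N))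
             (trans (*-congʳ (*-congʳ (t-zero N K≤M)))
               (solve 2 (λ y z → con (+ 0) :* y :* z := con (+ 0)) refl (1# - q ^ M) (poch M N))) ⟩
      Σ< M (λ n → s′ N n + q ^ suc N * s′ (suc N) n)
        ≈⟨ trans (Σ<-+ M (s′ N) _) (+-congˡ (Σ<-*ˡ M (q ^ suc N) (s′ (suc N)))) ⟩
      S′ N + q ^ suc N * S′ (suc N)
        ≈⟨ +-cong (S′≈S N) (*-congˡ (S′≈S (suc N))) ⟩
      S (suc N) + q ^ suc N * S (suc (suc N)) ∎

    -- Every term with n ≥ 1 carries a factor q^N, so only n = 0 survives. This is G_N → 1 after
    -- multiplication by (q)_∞.
    S-limit : ∀ {N} → K ≤ N → S N ≈ poch 0 N
    S-limit {N} K≤N = begin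
      S N                                          ≈⟨ Σ<-first M-1 (s N) ⟩
      s N 0 + Σ< M-1 (λ n → s N (suc n))           ≈⟨ +-cong first (Σ<-zero M-1 rest) ⟩
      poch 0 N + 0#                                ≈⟨ +-identityʳ _ ⟩
      poch 0 N                                     ∎
      where
      first : s N 0 ≈ poch 0 N
      first = trans (*-congʳ (*-congˡ (+-congˡ (-‿cong (*-congʳ (*-congʳ (^-congˡ 2 (q^≈0 K≤N))))))))
        (solve 2 (λ q p → con (+ 1) :* (con (+ 1) :- con (+ 0) :^ 2 :* con (+ 1) :^ 4 :* q :^ 2) :* p
            := p) refl q (poch 0 N))
      rest : ∀ n → s N (suc n) ≈ 0#
      rest n = trans (*-congʳ (*-congʳ (t-zero-N n K≤N)))
        (solve 2 (λ x y → con (+ 0) :* x :* y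
            := con (+ 0)) refl (1# - (q ^ N) ^ 2 * (q ^ suc n) ^ 4 * q ^ 2) (poch (suc n) N))

    private
      -- With Q = q^5 the theta exponent 2j + 5j(j-1)/2 is n(5n+1)/2 at j = -n and larger by 4n+2 at
      -- j = n + 1: the two terms of `s 0 n`.
      a b : Carrier
      a = q ^ 2
      b = q ^ 3

    Q^≈q^5 : ∀ m → (a * b) ^ m ≈ (q ^ m) ^ 5
    Q^≈q^5 m = begin
      (a * b) ^ m      ≈⟨ ^-congˡ m (^-homo-* q 2 3) ⟨
      (q ^ 5) ^ m      ≈⟨ ^-assocʳ q 5 m ⟩
      q ^ (5 ℕ.* m)    ≡⟨ ≡.cong (q ^_) (ℕ.*-comm 5 m) ⟩
      q ^ (m ℕ.* 5)    ≈⟨ ^-assocʳ q m 5 ⟨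
      (q ^ m) ^ 5      ∎

    Q^≈0 : ∀ {m} → K ≤ m → (a * b) ^ m ≈ 0#
    Q^≈0 {m} K≤m = trans (Q^≈q^5 m) (trans (^-congˡ 5 (q^≈0 K≤m)) (solve 0 (con (+ 0) :^ 5 := con (+ 0)) refl))

    1-Q^≈1 : ∀ {m} → K ≤ m → 1# - (a * b) ^ m ≈ 1#
    1-Q^≈1 K≤m = trans (+-congˡ (-‿cong (Q^≈0 K≤m))) (solve 0 (con (+ 1) :- con (+ 0) := con (+ 1)) refl)

    u : ℕ → Carrier
    u k = Π< M (λ i → 1# - (a * b) ^ suc (k ℕ.+ i))

    u-step : ∀ k → u k ≈ (1# - (a * b) ^ suc k) * u (suc k)
    u-step k = Π<-shift M (λ i → 1# - (a * b) ^ suc i) k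
      (1-Q^≈1 (ℕ.m≤n⇒m≤1+n (ℕ.≤-trans K≤M (ℕ.m≤n+m M k))))

    u≈1 : ∀ {k} → K ≤ k → u k ≈ 1#
    u≈1 {k} K≤k = Π<-one M _ (λ i → 1-Q^≈1 (ℕ.m≤n⇒m≤1+n (ℕ.≤-trans K≤k (ℕ.m≤m+n k i))))

    open TripleProduct R
    private
      half′ : Carrier → ℕ → Carrier
      half′ = half a b u u-step
      w′ : ℕ → ℕ → Carrier
      w′ = w a b u u-step

    half-zero : ∀ e {d} → K ≤ d → half′ (q ^ suc e) d ≈ 0#
    -- Here K = 0, so the ring is trivial.
    half-zero e {zero}  K≤d = begin
      1#       ≡⟨⟩
      q ^ 0    ≈⟨ q^≈0 K≤d ⟩
      0#       ∎
    half-zero e {suc k} K≤d = begin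
      - (q ^ suc e * (a * b) ^ k * half′ (q ^ suc e) k)
        ≈⟨ -‿cong (*-congʳ (*-congˡ (Q^≈q^5 k))) ⟩
      - (q * q ^ e * (q ^ k) ^ 5 * half′ (q ^ suc e) k)
        ≈⟨ solve 4 (λ q x y h → :- (q :* x :* y :^ 5 :* h)
            := (q :* y) :* (:- (x :* y :^ 4 :* h))) refl q (q ^ e) (q ^ k) _ ⟩
      q ^ suc k * - (q ^ e * (q ^ k) ^ 4 * half′ (q ^ suc e) k)
        ≈⟨ trans (*-congʳ (q^≈0 K≤d)) (zeroˡ _) ⟩
      0# ∎

    t≈half : ∀ n → t 0 n ≈ half′ b n
    t≈half zero    = refl
    t≈half (suc n) = -‿cong (begin
      1# ^ 2 * (q ^ n) ^ 5 * b * t 0 n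
        ≈⟨ solve 3 (λ y b t → con (+ 1) :^ 2 :* y :* b :* t := b :* y :* t) refl ((q ^ n) ^ 5) b (t 0 n) ⟩
      b * (q ^ n) ^ 5 * t 0 n            ≈⟨ *-cong (*-congˡ (sym (Q^≈q^5 n))) (t≈half n) ⟩
      b * (a * b) ^ n * half′ b n        ∎)

    half-suc≈t : ∀ n → half′ a (suc n) ≈ - ((q ^ n) ^ 4 * q ^ 2 * t 0 n)
    half-suc≈t zero    = -‿cong (solve 1 (λ a → a :* con (+ 1) :* con (+ 1)
        := con (+ 1) :^ 4 :* a :* con (+ 1)) refl a)
    half-suc≈t (suc n) = begin
      - (a * (a * b) ^ suc n * half′ a (suc n))
        ≈⟨ -‿cong (*-cong (*-congˡ (Q^≈q^5 (suc n))) (half-suc≈t n)) ⟩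
      - (q ^ 2 * (q * q ^ n) ^ 5 * - ((q ^ n) ^ 4 * q ^ 2 * t 0 n))
        ≈⟨ solve 3 (λ q y t → :- (q :^ 2 :* (q :* y) :^ 5 :* :- (y :^ 4 :* q :^ 2 :* t))
              := :- ((q :* y) :^ 4 :* q :^ 2 :* :- (con (+ 1) :^ 2 :* y :^ 5 :* q :^ 3 :* t)))
                refl q (q ^ n) (t 0 n) ⟩
      - ((q ^ suc n) ^ 4 * q ^ 2 * t 0 (suc n)) ∎

    s-zero : ∀ n → s 0 n ≈ half′ b n + half′ a (suc n)
    s-zero n = begin
      t 0 n * (1# - 1# ^ 2 * (q ^ n) ^ 4 * q ^ 2) * 1#
        ≈⟨ solve 3 (λ t y q → t :* (con (+ 1) :- con (+ 1) :^ 2 :* y :* q) :* con (+ 1)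
            := t :+ :- (y :* q :* t)) refl (t 0 n) ((q ^ n) ^ 4) (q ^ 2) ⟩
      t 0 n + - ((q ^ n) ^ 4 * q ^ 2 * t 0 n)
        ≈⟨ +-cong (t≈half n) (sym (half-suc≈t n)) ⟩
      half′ b n + half′ a (suc n) ∎

    S-zero : S 0 ≈ conv (λ i _ → w′ M i) (M ℕ.* 2)
    S-zero = begin
      Σ< M (s 0)                                              ≈⟨ Σ<-cong M s-zero ⟩
      Σ< M (λ n → half′ b n + half′ a (suc n))                ≈⟨ +-identityʳ _ ⟨
      Σ< M (λ n → half′ b n + half′ a (suc n)) + 0#           ≈⟨ +-congˡ (half-zero 2 K≤M) ⟨
      Σ< M (λ n → half′ b n + half′ a (suc n)) + half′ b M    ≈⟨ w-sum a b u u-step M ⟨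
      conv (λ i _ → w′ M i) (M ℕ.* 2)                         ∎

    w-low : ∀ {i} → i ≤ K → w′ M i ≈ 0#
    w-low {i} i≤K = begin
      w′ M i                  ≡⟨ ≡.cong (λ m → w′ m i) (ℕ.m+[n∸m]≡n (ℕ.≤-trans i≤K K≤M)) ⟨
      w′ (i ℕ.+ (M ∸ i)) i    ≈⟨ w-below a b u u-step i (M ∸ i) ⟩
      half′ b (M ∸ i)         ≈⟨ half-zero 2 (ℕ.≤-trans (ℕ.m+n≤o⇒m≤o∸n K K+K≤M) (ℕ.∸-monoʳ-≤ M i≤K)) ⟩
      0#                      ∎

    w-high : ∀ {i j} → i ℕ.+ j ≡ M ℕ.* 2 → j ≤ K → w′ M i ≈ 0#
    w-high {i} {j} eq j≤K = begin
      w′ M i                  ≡⟨ ≡.cong (w′ M) i≡ ⟩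
      w′ M (M ℕ.+ (M ∸ j))    ≈⟨ w-above a b u u-step M (M ∸ j) ⟩
      half′ a (M ∸ j)         ≈⟨ half-zero 1 (ℕ.≤-trans (ℕ.m+n≤o⇒m≤o∸n K K+K≤M) (ℕ.∸-monoʳ-≤ M j≤K)) ⟩
      0#                      ∎
      where
      i≡ : i ≡ M ℕ.+ (M ∸ j)
      i≡ = ≡.trans (≡.sym (ℕ.m+n∸n≡m i j)) (≡.trans (≡.cong (_∸ j) (≡.trans eq (n*2≡n+n M)))
             (ℕ.+-∸-assoc M (ℕ.≤-trans j≤K K≤M)))

    -- Where a tail may differ from 1 the theta coefficient is already 0. This is the passage from
    -- the finite identity to Jacobi's.
    w-absorbs-u : ∀ i j → i ℕ.+ j ≡ M ℕ.* 2 → w′ M i * (u i * u j) ≈ w′ M i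
    w-absorbs-u i j eq = cases (ℕ.≤-total K i) (ℕ.≤-total K j)
      where
      vanishing : w′ M i ≈ 0# → w′ M i * (u i * u j) ≈ w′ M i
      vanishing w≈0 = trans (*-congʳ w≈0) (trans (zeroˡ _) (sym w≈0))
      cases : K ≤ i ⊎ i ≤ K → K ≤ j ⊎ j ≤ K → w′ M i * (u i * u j) ≈ w′ M i
      cases (inj₂ i≤K) _          = vanishing (w-low i≤K)
      cases (inj₁ _)   (inj₂ j≤K) = vanishing (w-high eq j≤K)
      cases (inj₁ K≤i) (inj₁ K≤j) =
        trans (*-congˡ (trans (*-cong (u≈1 K≤i) (u≈1 K≤j)) (*-identityʳ 1#))) (*-identityʳ _)

    Π1-Q^-cancelˡ : ∀ n x y → Π< n (λ i → 1# - (a * b) ^ suc i) * x ≈ Π< n (λ i → 1# - (a * b) ^ suc i) * y → x ≈ y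
    Π1-Q^-cancelˡ n x y eq = Π1-q^-cancelˡ n (λ i → 4 ℕ.+ i ℕ.* 5) x y
      (trans (*-congʳ conv-exp) (trans eq (*-congʳ (sym conv-exp))))
      where
      conv-exp = Π<-cong n (λ i → +-congˡ (-‿cong (sym (trans (Q^≈q^5 (suc i)) (^-assocʳ q (suc i) 5)))))

    -- The finite identity has `u 0` twice on the right, and on the left (Q)_(2M), which equals
    -- `u 0` at this precision. One copy cancels, the other is the third product.
    theta : S 0 ≈ Π< M (λ i → (1# - a * (a * b) ^ i) * (1# - b * (a * b) ^ i)) * Π< M (λ i → 1# - (a * b) ^ suc i)
    theta = Π1-Q^-cancelˡ M _ _ (begin
      Π< M (λ i → 1# - (a * b) ^ suc i) * S 0
        ≈⟨ *-cong (sym (trans (reflexive (≡.cong (λ m → Π< m (λ i → 1# - (a * b) ^ suc i)) (n*2≡n+n M)))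
             (Π<-tail M M _ (λ i M≤i → 1-Q^≈1 (ℕ.m≤n⇒m≤1+n (ℕ.≤-trans K≤M M≤i)))))) S-zero ⟩
      Π< (M ℕ.* 2) (λ i → 1# - (a * b) ^ suc i) * conv (λ i _ → w′ M i) (M ℕ.* 2)
        ≈⟨ *-congˡ (conv-cong (M ℕ.* 2) w-absorbs-u) ⟨
      Π< (M ℕ.* 2) (λ i → 1# - (a * b) ^ suc i) * conv (λ i j → w′ M i * (u i * u j)) (M ℕ.* 2)
        ≈⟨ finiteTripleProduct a b u u-step M ⟩
      Π< M (λ i → (1# - a * (a * b) ^ i) * (1# - b * (a * b) ^ i)) * (u 0 * u 0)
        ≈⟨ solve 2 (λ p u → p :* (u :* u) := u :* (p :* u)) refl _ (u 0) ⟩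
      u 0 * (Π< M (λ i → (1# - a * (a * b) ^ i) * (1# - b * (a * b) ^ i)) * u 0) ∎)

-- Generating functions of the two families

module GeneratingFunctions
  (R : CommutativeRing 0ℓ 0ℓ) (q : CommutativeRing.Carrier R) (K : ℕ)
  (q^K≈0 : CommutativeRing._≈_ R (Exp._^_ (CommutativeRing.semiring R) q K) (CommutativeRing.0# R))
  (M-1 : ℕ) (K+K≤M : K ℕ.+ K ≤ suc M-1) where
  open CommutativeRing R hiding (zero)
  open Exp semiring
  open IntegerSolver R
  open Sums R
  open Nilpotent R q K q^K≈0
  open Series M-1 K+K≤M
  open import Relation.Binary.Reasoning.Setoid setoid

  D : ℕ → Carrier
  D N = Π< M (λ i → 1# + q ^ suc (N ℕ.+ i))

  D-step : ∀ N → D N ≈ (1# + q ^ suc N) * D (suc N)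
  D-step N = Π<-shift M (λ i → 1# + q ^ suc i) N (1+q^≈1 (ℕ.m≤n⇒m≤1+n (ℕ.≤-trans K≤M (ℕ.m≤n+m M N))))

  D-product : ∀ N → D 0 ≈ Π< N (λ i → 1# + q ^ suc i) * D N
  D-product zero    = sym (*-identityˡ _)
  D-product (suc N) = trans (D-product N) (trans (*-congˡ (D-step N)) (sym (*-assoc _ _ _)))

  D≈1 : ∀ {N} → K ≤ N → D N ≈ 1#
  D≈1 {N} K≤N = Π<-one M _ (λ i → 1+q^≈1 (ℕ.m≤n⇒m≤1+n (ℕ.≤-trans K≤N (ℕ.m≤m+n N i))))

  infixr 7.5 [_]_
  [_]_ : Bool → Carrier → Carrier
  [ true  ] x = x
  [ false ] x = 0#

  indicator-step : ∀ g s m k w x → ([ g ∧ s ] q ^ (k ℕ.* m ℕ.+ w)) * x ≈ ([ g ] q ^ w) * (([ s ] ((q ^ m) ^ k)) * x)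
  indicator-step false s     m k w x = trans (zeroˡ _) (sym (zeroˡ _))
  indicator-step true  false m k w x = trans (zeroˡ x) (sym (trans (*-congˡ (zeroˡ x)) (zeroʳ _)))
  indicator-step true  true  m k w x = begin
    q ^ (k ℕ.* m ℕ.+ w) * x         ≈⟨ *-congʳ (^-homo-* q (k ℕ.* m) w) ⟩
    q ^ (k ℕ.* m) * q ^ w * x       ≡⟨ ≡.cong (λ e → q ^ e * q ^ w * x) (ℕ.*-comm k m) ⟩
    q ^ (m ℕ.* k) * q ^ w * x       ≈⟨ *-congʳ (*-congʳ (^-assocʳ q m k)) ⟨
    (q ^ m) ^ k * q ^ w * x         ≈⟨ solve 3 (λ z w x → z :* w :* x := w :* (z :* x)) refl _ _ _ ⟩
    q ^ w * ((q ^ m) ^ k * x)       ∎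

  Σ<-3 : ∀ B f → (∀ i → f (3 ℕ.+ i) ≈ 0#) → Σ< (3 ℕ.+ B) f ≈ f 0 + (f 1 + f 2)
  Σ<-3 B f f≈0 = begin
    Σ< (3 ℕ.+ B) f        ≈⟨ Σ<-first (2 ℕ.+ B) f ⟩
    f 0 + Σ< (2 ℕ.+ B) _  ≈⟨ +-congˡ (Σ<-first (1 ℕ.+ B) (λ i → f (suc i))) ⟩
    f 0 + (f 1 + Σ< (1 ℕ.+ B) _) ≈⟨ +-congˡ (+-congˡ (Σ<-first B (λ i → f (2 ℕ.+ i)))) ⟩
    f 0 + (f 1 + (f 2 + Σ< B _)) ≈⟨ +-congˡ (+-congˡ (trans (+-congˡ (Σ<-zero B f≈0)) (+-identityʳ _))) ⟩
    f 0 + (f 1 + f 2)     ∎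

  -- (q)_∞ times the generating function of the ways to add parts of size greater than N to a configuration, in terms
  -- of its number of parts of size N and the parity of its number of overlined parts.
  completions : ℕ → ℕ → Bool → Carrier
  completions N 0             _     = D N * S N
  completions N 1             false = D N * S N
  completions N 1             true  = D N * S (suc N)
  completions N (suc (suc _)) false = D (suc N) * S N
  completions N (suc (suc _)) true  = D N * S (suc N)

  private
    contribution : ℕ → ℕ → Bool → Bool → ℕ → Carrier
    contribution N c v b f = ([ step c v b f ] ((q ^ suc N) ^ (bit b ℕ.+ f)))
        * completions (suc N) (bit b ℕ.+ f) (b xor v)

    -- `fits` rejects three equal plain parts, so six options per size remain: at most two plain
    -- parts, with or without the overlined one.
    contribution-3 : ∀ N c v b i → contribution N c v b (3 ℕ.+ i) ≈ 0#
    contribution-3 N c v b i = zeroˡ _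

  module _ (N : ℕ) where
    private
      z d d₂ s₁ s₂ : Carrier
      z  = q ^ suc N
      d  = D (suc N)
      d₂ = D (suc (suc N))
      s₁ = S (suc N)
      s₂ = S (suc (suc N))

      DS≈ : D N * S N ≈ (1# + z) * d * (s₁ + z * s₂)
      DS≈ = *-cong (D-step N) (S-rec N)

    -- The zero coefficients are the options that `step` rejects. A state with D_N G_N needs both
    -- recurrences, one with D_N G_(N+1) only that of D, one with D_(N+1) G_N only that of G.
    completions-rec′ : ∀ c v →
      (contribution N c v false 0 + (contribution N c v false 1 + contribution N c v false 2))
      + (contribution N c v true 0 + (contribution N c v true 1 + contribution N c v true 2)) ≈ completions N c v
    completions-rec′ 0 false = trans
      (solve 5 (λ z d d₂ s₁ s₂ →
        (z :^ 0 :* (d :* s₁) :+ (z :^ 1 :* (d :* s₁) :+ con (+ 0) :* (d₂ :* s₁)))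
        :+ (z :^ 1 :* (d :* s₂) :+ (z :^ 2 :* (d :* s₂) :+ con (+ 0) :* (d :* s₂)))
        := (con (+ 1) :+ z) :* d :* (s₁ :+ z :* s₂)) refl z d d₂ s₁ s₂) (sym DS≈)
    completions-rec′ 0 true = trans
      (solve 5 (λ z d d₂ s₁ s₂ →
        (z :^ 0 :* (d :* s₁) :+ (z :^ 1 :* (d :* s₂) :+ z :^ 2 :* (d :* s₂)))
        :+ (z :^ 1 :* (d :* s₁) :+ (con (+ 0) :* (d₂ :* s₁) :+ con (+ 0) :* (d₂ :* s₁)))
        := (con (+ 1) :+ z) :* d :* (s₁ :+ z :* s₂)) refl z d d₂ s₁ s₂) (sym DS≈)
    completions-rec′ 1 false = trans
      (solve 5 (λ z d d₂ s₁ s₂ →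
        (z :^ 0 :* (d :* s₁) :+ (z :^ 1 :* (d :* s₁) :+ con (+ 0) :* (d₂ :* s₁)))
        :+ (z :^ 1 :* (d :* s₂) :+ (z :^ 2 :* (d :* s₂) :+ con (+ 0) :* (d :* s₂)))
        := (con (+ 1) :+ z) :* d :* (s₁ :+ z :* s₂)) refl z d d₂ s₁ s₂) (sym DS≈)
    completions-rec′ 1 true = trans
      (solve 5 (λ z d d₂ s₁ s₂ →
        (z :^ 0 :* (d :* s₁) :+ (con (+ 0) :* (d :* s₂) :+ con (+ 0) :* (d :* s₂)))
        :+ (z :^ 1 :* (d :* s₁) :+ (con (+ 0) :* (d₂ :* s₁) :+ con (+ 0) :* (d₂ :* s₁)))
        := (con (+ 1) :+ z) :* d :* s₁) refl z d d₂ s₁ s₂) (sym (*-congʳ (D-step N)))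
    completions-rec′ (suc (suc c)) false = trans
      (solve 5 (λ z d d₂ s₁ s₂ →
        (z :^ 0 :* (d :* s₁) :+ (con (+ 0) :* (d :* s₁) :+ con (+ 0) :* (d₂ :* s₁)))
        :+ (z :^ 1 :* (d :* s₂) :+ (con (+ 0) :* (d :* s₂) :+ con (+ 0) :* (d :* s₂)))
        := d :* (s₁ :+ z :* s₂)) refl z d d₂ s₁ s₂) (sym (*-congˡ (S-rec N)))
    completions-rec′ (suc (suc c)) true = trans
      (solve 5 (λ z d d₂ s₁ s₂ →
        (z :^ 0 :* (d :* s₁) :+ (con (+ 0) :* (d :* s₂) :+ con (+ 0) :* (d :* s₂)))
        :+ (z :^ 1 :* (d :* s₁) :+ (con (+ 0) :* (d₂ :* s₁) :+ con (+ 0) :* (d₂ :* s₁)))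
        := (con (+ 1) :+ z) :* d :* s₁) refl z d d₂ s₁ s₂) (sym (*-congʳ (D-step N)))

    completions-rec : ∀ B c v →
      Σ< (3 ℕ.+ B) (contribution N c v false) + Σ< (3 ℕ.+ B) (contribution N c v true) ≈ completions N c v
    completions-rec B c v = trans
      (+-cong (Σ<-3 B _ (contribution-3 N c v false)) (Σ<-3 B _ (contribution-3 N c v true)))
      (completions-rec′ c v)

  goodTerm : ∀ N → OP N → Carrier
  goodTerm N o = [ good N o ] q ^ weight N o

  -- Weighting each configuration by its completions counts the same objects at every cut N;
  -- `completions-rec` is the step from one cut to the next.
  good-invariant : ∀ B N →
    ΣOP (3 ℕ.+ B) N (λ o → goodTerm N o * completions N (topCount N o) (oddOver N o)) ≈ D 0 * S 0
  good-invariant B zero    = *-identityˡ _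
  good-invariant B (suc N) = trans (ΣOP-cong (3 ℕ.+ B) N collect) (good-invariant B N)
    where
    collect : ∀ o →
      Σ< (3 ℕ.+ B) (λ f → goodTerm (suc N) (false , f , o) * completions (suc N) f (oddOver N o))
      + Σ< (3 ℕ.+ B) (λ f → goodTerm (suc N) (true , f , o) * completions (suc N) (suc f) (not (oddOver N o)))
      ≈ goodTerm N o * completions N (topCount N o) (oddOver N o)
    collect o = begin
      _ ≈⟨ +-cong (Σ<-cong (3 ℕ.+ B) λ f → indicator-step (good N o) (step c v false f) (suc N) f (weight N o) _)
                  (Σ<-cong (3 ℕ.+ B) λ f → indicator-step (good N o) (step c v true f) (suc N) (suc f) (weight N o) _) ⟩
      Σ< (3 ℕ.+ B) (λ f → goodTerm N o * contribution N c v false f)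
          + Σ< (3 ℕ.+ B) (λ f → goodTerm N o * contribution N c v true f)
        ≈⟨ +-cong (Σ<-*ˡ (3 ℕ.+ B) (goodTerm N o) (contribution N c v false))
            (Σ<-*ˡ (3 ℕ.+ B) (goodTerm N o) (contribution N c v true)) ⟩
      goodTerm N o * Σ< (3 ℕ.+ B) (contribution N c v false) + goodTerm N o * Σ< (3 ℕ.+ B) (contribution N c v true)
        ≈⟨ distribˡ _ _ _ ⟨
      goodTerm N o * (Σ< (3 ℕ.+ B) (contribution N c v false) + Σ< (3 ℕ.+ B) (contribution N c v true))
        ≈⟨ *-congˡ (completions-rec N B c v) ⟩
      goodTerm N o * completions N c v ∎
      where
      c = topCount N o
      v = oddOver N o

  -- Parts larger than N ≥ K are invisible at this precision, so the states become
  -- indistinguishable.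
  completions-limit : ∀ {N} c v → K ≤ N → completions N c v ≈ poch 0 N
  completions-limit {N} c v K≤N = go c v
    where
    K≤1+N = ℕ.m≤n⇒m≤1+n K≤N
    S₁ : S (suc N) ≈ poch 0 N
    S₁ = trans (S-limit K≤1+N) (trans (*-congˡ (1-q^≈1 K≤1+N)) (*-identityʳ _))
    unit : ∀ {x y} → x ≈ 1# → y ≈ poch 0 N → x * y ≈ poch 0 N
    unit x≈1 y≈p = trans (*-cong x≈1 y≈p) (*-identityˡ _)
    go : ∀ c v → completions N c v ≈ poch 0 N
    go 0             _     = unit (D≈1 K≤N) (S-limit K≤N)
    go 1             false = unit (D≈1 K≤N) (S-limit K≤N)
    go 1             true  = unit (D≈1 K≤N) S₁
    go (suc (suc _)) false = unit (D≈1 K≤1+N) (S-limit K≤N)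
    go (suc (suc _)) true  = unit (D≈1 K≤N) S₁

  good-gf : ∀ B {N} → K ≤ N → ΣOP (3 ℕ.+ B) N (goodTerm N) * poch 0 N ≈ D 0 * S 0
  good-gf B {N} K≤N = begin
    ΣOP (3 ℕ.+ B) N (goodTerm N) * poch 0 N
      ≈⟨ ΣOP-*ʳ (3 ℕ.+ B) N (poch 0 N) (goodTerm N) ⟨
    ΣOP (3 ℕ.+ B) N (λ o → goodTerm N o * poch 0 N)
      ≈⟨ ΣOP-cong (3 ℕ.+ B) N (λ o → *-congˡ (completions-limit (topCount N o) (oddOver N o) K≤N)) ⟨
    ΣOP (3 ℕ.+ B) N (λ o → goodTerm N o * completions N (topCount N o) (oddOver N o))
      ≈⟨ good-invariant B N ⟩
    D 0 * S 0 ∎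

  restrictedTerm : ∀ N → OP N → Carrier
  restrictedTerm N o = [ restricted N o ] q ^ weight N o

  partFactor : ℕ → ℕ → Carrier
  partFactor B m = Σ< B (λ f → [ allows m f ] ((q ^ m) ^ f))

  restricted-gf : ∀ B N →
    ΣOP B N (restrictedTerm N) ≈ Π< N (λ i → partFactor B (suc i) * (1# + q ^ suc i))
  restricted-gf B zero    = refl
  restricted-gf B (suc N) = begin
    _ ≈⟨ ΣOP-cong B N collect ⟩
    ΣOP B N (λ o → restrictedTerm N o * (partFactor B (suc N) * (1# + q ^ suc N)))
      ≈⟨ ΣOP-*ʳ B N _ (restrictedTerm N) ⟩
    ΣOP B N (restrictedTerm N) * (partFactor B (suc N) * (1# + q ^ suc N))
      ≈⟨ *-congʳ (restricted-gf B N) ⟩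
    Π< N (λ i → partFactor B (suc i) * (1# + q ^ suc i)) * (partFactor B (suc N) * (1# + q ^ suc N)) ∎
    where
    z = q ^ suc N
    term : OP N → ℕ → Carrier
    term o f = restrictedTerm N o * [ allows (suc N) f ] (z ^ f)
    plain : ∀ o f → restrictedTerm (suc N) (false , f , o) ≈ term o f
    plain o f = begin
      _                      ≈⟨ *-identityʳ _ ⟨
      _ * 1#                 ≈⟨ indicator-step (restricted N o) (allows (suc N) f) (suc N) f (weight N o) 1# ⟩
      restrictedTerm N o * (([ allows (suc N) f ] (z ^ f)) * 1#) ≈⟨ *-congˡ (*-identityʳ _) ⟩
      term o f               ∎
    pull : ∀ s f → [ s ] (z ^ suc f) ≈ z * [ s ] (z ^ f)
    pull true  f = refl
    pull false f = sym (zeroʳ z)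
    overlined : ∀ o f → restrictedTerm (suc N) (true , f , o) ≈ z * term o f
    overlined o f = begin
      _                      ≈⟨ *-identityʳ _ ⟨
      _ * 1#                 ≈⟨ indicator-step (restricted N o) (allows (suc N) f) (suc N) (suc f) (weight N o) 1# ⟩
      restrictedTerm N o * (([ allows (suc N) f ] (z ^ suc f)) * 1#)
        ≈⟨ *-congˡ (trans (*-identityʳ _) (pull (allows (suc N) f) f)) ⟩
      restrictedTerm N o * (z * [ allows (suc N) f ] (z ^ f))
        ≈⟨ solve 3 (λ r z x → r :* (z :* x) := z :* (r :* x)) refl _ _ _ ⟩
      z * term o f           ∎
    collect : ∀ o → Σ< B (λ f → restrictedTerm (suc N) (false , f , o))
        + Σ< B (λ f → restrictedTerm (suc N) (true , f , o))
                    ≈ restrictedTerm N o * (partFactor B (suc N) * (1# + q ^ suc N))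
    collect o = begin
      _ ≈⟨ +-cong (Σ<-cong B (plain o)) (trans (Σ<-cong B (overlined o)) (Σ<-*ˡ B z (term o))) ⟩
      Σ< B (term o) + z * Σ< B (term o)
        ≈⟨ solve 2 (λ s z → s :+ z :* s := s :* (con (+ 1) :+ z)) refl _ z ⟩
      Σ< B (term o) * (1# + z)
        ≈⟨ *-congʳ (Σ<-*ˡ B (restrictedTerm N o) _) ⟩
      restrictedTerm N o * partFactor B (suc N) * (1# + z)
        ≈⟨ *-assoc _ _ _ ⟩
      restrictedTerm N o * (partFactor B (suc N) * (1# + z)) ∎

  -- `ψ m` is the inverse of the series of plain parts of size m, and `χ m` its cofactor in 1 - q^m,
  -- so the two sides can be compared after multiplication by (q)_N.
  ψ χ : ℕ → Carrier
  ψ m = if ±1mod5 m then 1# - q ^ m else 1#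
  χ m = if ±1mod5 m then 1# else 1# - q ^ m

  ψχ : ∀ m → ψ m * χ m ≈ 1# - q ^ m
  ψχ m with ±1mod5 m
  ... | true  = *-identityʳ _
  ... | false = *-identityˡ _

  geometric : ∀ B z → Σ< B (λ f → z ^ f) * (1# - z) ≈ 1# - z ^ B
  geometric zero    z = solve 1 (λ z → con (+ 0) :* (con (+ 1) :- z) := con (+ 1) :- con (+ 1)) refl z
  geometric (suc B) z = begin
    (Σ< B (λ f → z ^ f) + z ^ B) * (1# - z)            ≈⟨ distribʳ _ _ _ ⟩
    Σ< B (λ f → z ^ f) * (1# - z) + z ^ B * (1# - z)   ≈⟨ +-congʳ (geometric B z) ⟩
    (1# - z ^ B) + z ^ B * (1# - z)
      ≈⟨ solve 2 (λ y z → (con (+ 1) :- y) :+ y :* (con (+ 1) :- z) := con (+ 1) :- z :* y) refl (z ^ B) z ⟩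
    1# - z ^ suc B                                     ∎

  partFactor-ψ : ∀ B m → K ≤ suc B → partFactor (suc B) (suc m) * ψ (suc m) ≈ 1#
  partFactor-ψ B m K≤B with ±1mod5 (suc m) in eq
  ... | true = begin
    partFactor (suc B) (suc m) * (1# - z)      ≈⟨ *-congʳ (Σ<-cong (suc B) all) ⟩
    Σ< (suc B) (λ f → z ^ f) * (1# - z)        ≈⟨ geometric (suc B) z ⟩
    1# - z ^ suc B
      ≈⟨ +-congˡ (-‿cong (trans (^-assocʳ q (suc m) (suc B))
          (q^≈0 (ℕ.≤-trans K≤B (ℕ.m≤m+n (suc B) (m ℕ.* suc B)))))) ⟩
    1# - 0#                                    ≈⟨ solve 0 (con (+ 1) :- con (+ 0) := con (+ 1)) refl ⟩
    1#                                         ∎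
    where
    z = q ^ suc m
    all : ∀ f → [ allows (suc m) f ] (z ^ f) ≈ z ^ f
    all zero = refl
    all (suc f) rewrite eq = refl
  ... | false = begin
    partFactor (suc B) (suc m) * 1#            ≈⟨ *-identityʳ _ ⟩
    partFactor (suc B) (suc m)                 ≈⟨ Σ<-first B (λ f → [ allows (suc m) f ] (z ^ f)) ⟩
    1# + Σ< B (λ f → [ ±1mod5 (suc m) ] (z ^ suc f)) ≈⟨ +-congˡ (Σ<-zero B none) ⟩
    1# + 0#                                    ≈⟨ +-identityʳ 1# ⟩
    1#                                         ∎
    where
    z = q ^ suc m
    none : ∀ f → [ ±1mod5 (suc m) ] (z ^ suc f) ≈ 0#
    none f rewrite eq = refl

  ±1mod5-periodic : ∀ r k → ±1mod5 (r ℕ.+ k ℕ.* 5) ≡ ±1mod5 r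
  ±1mod5-periodic r k = ≡.cong (λ m → (m ≡ᵇ 1) ∨ (m ≡ᵇ 4)) ([m+kn]%n≡m%n r k 5)

  χ-at : ∀ r k → χ (r ℕ.+ k ℕ.* 5) ≡ (if ±1mod5 r then 1# else 1# - q ^ (r ℕ.+ k ℕ.* 5))
  χ-at r k = ≡.cong (λ b → if b then 1# else 1# - q ^ (r ℕ.+ k ℕ.* 5)) (±1mod5-periodic r k)

  -- In each block of five the residues 2, 3 and 0 supply the three factors of the triple product
  -- for q^2 and q^3; hence sizes run up to a multiple of five.
  χ-blocks : ∀ k → Π< (k ℕ.* 5) (λ i → χ (suc i)) ≈
    Π< k (λ i → (1# - q ^ 2 * (q ^ 2 * q ^ 3) ^ i) * (1# - q ^ 3 * (q ^ 2 * q ^ 3) ^ i))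
    * Π< k (λ i → 1# - (q ^ 2 * q ^ 3) ^ suc i)
  χ-blocks zero    = sym (*-identityˡ 1#)
  χ-blocks (suc k) = begin
    Π< (k ℕ.* 5) (λ i → χ (suc i)) * χ (1 ℕ.+ x) * χ (2 ℕ.+ x) * χ (3 ℕ.+ x) * χ (4 ℕ.+ x) * χ (5 ℕ.+ x)
      ≈⟨ *-cong (*-cong (*-cong (*-cong (*-cong (χ-blocks k)
           (reflexive (χ-at 1 k))) (reflexive (χ-at 2 k))) (reflexive (χ-at 3 k)))
               (reflexive (χ-at 4 k))) (reflexive (χ-at 5 k)) ⟩
    (A * C) * 1# * (1# - q ^ (2 ℕ.+ x)) * (1# - q ^ (3 ℕ.+ x)) * 1# * (1# - q ^ (5 ℕ.+ x))
      ≈⟨ *-cong (*-congʳ (*-cong (*-congˡ (minus (pow 2))) (minus (pow 3)))) (minus pow5) ⟩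
    (A * C) * 1# * α * β * 1# * γ
      ≈⟨ solve 5 (λ A C α β γ → (A :* C) :* con (+ 1) :* α :* β :* con (+ 1) :* γ
          := (A :* (α :* β)) :* (C :* γ)) refl A C α β γ ⟩
    (A * (α * β)) * (C * γ) ∎
    where
    x = k ℕ.* 5
    A = Π< k (λ i → (1# - q ^ 2 * (q ^ 2 * q ^ 3) ^ i) * (1# - q ^ 3 * (q ^ 2 * q ^ 3) ^ i))
    C = Π< k (λ i → 1# - (q ^ 2 * q ^ 3) ^ suc i)
    α = 1# - q ^ 2 * (q ^ 2 * q ^ 3) ^ k
    β = 1# - q ^ 3 * (q ^ 2 * q ^ 3) ^ k
    γ = 1# - (q ^ 2 * q ^ 3) ^ suc k
    minus : ∀ {x y} → x ≈ y → 1# - x ≈ 1# - y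
    minus eq = +-congˡ (-‿cong eq)
    pow : ∀ r → q ^ (r ℕ.+ x) ≈ q ^ r * (q ^ 2 * q ^ 3) ^ k
    pow r = trans (^-homo-* q r x) (*-congˡ (sym (trans (Q^≈q^5 k) (^-assocʳ q k 5))))
    pow5 : q ^ (5 ℕ.+ x) ≈ (q ^ 2 * q ^ 3) ^ suc k
    pow5 = sym (trans (Q^≈q^5 (suc k)) (^-assocʳ q (suc k) 5))

  -- N is kept a variable so that sums over OP N do not unfold.
  good≈restricted : ∀ B {N} → K ≤ 3 ℕ.+ B → N ≡ M ℕ.* 5 →
    ΣOP (3 ℕ.+ B) N (goodTerm N) ≈ ΣOP (3 ℕ.+ B) N (restrictedTerm N)
  good≈restricted B {N} K≤B N≡5M = Π1-q^-cancelˡ N (λ i → i) _ _ (begin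
    poch 0 N * ΣOP (3 ℕ.+ B) N (goodTerm N)
      ≈⟨ trans (*-comm _ _) (good-gf B K≤N) ⟩
    D 0 * S 0
      ≈⟨ *-cong (trans (D-product N) (trans (*-congˡ (D≈1 K≤N)) (*-identityʳ _))) (trans theta (sym χ-product)) ⟩
    Π< N (λ i → 1# + q ^ suc i) * Π< N (λ i → χ (suc i))
      ≈⟨ Π<-* N _ _ ⟨
    Π< N (λ i → (1# + q ^ suc i) * χ (suc i))
      ≈⟨ Π<-cong N factor ⟩
    Π< N (λ i → (1# - q ^ suc i) * (partFactor (3 ℕ.+ B) (suc i) * (1# + q ^ suc i)))
      ≈⟨ Π<-* N _ _ ⟩
    poch 0 N * Π< N (λ i → partFactor (3 ℕ.+ B) (suc i) * (1# + q ^ suc i))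
      ≈⟨ *-congˡ (restricted-gf (3 ℕ.+ B) N) ⟨
    poch 0 N * ΣOP (3 ℕ.+ B) N (restrictedTerm N) ∎)
    where
    K≤N : K ≤ N
    K≤N = ℕ.≤-trans K≤M (ℕ.≤-trans (ℕ.m≤m*n M 5) (ℕ.≤-reflexive (≡.sym N≡5M)))
    χ-product = trans (reflexive (≡.cong (λ n → Π< n (λ i → χ (suc i))) N≡5M)) (χ-blocks M)
    factor : ∀ i → (1# + q ^ suc i) * χ (suc i) ≈ (1# - q ^ suc i) * (partFactor (3 ℕ.+ B) (suc i) * (1# + q ^ suc i))
    factor i = sym (begin
      (1# - q ^ suc i) * (g * e)       ≈⟨ *-congʳ (ψχ (suc i)) ⟨
      ψ (suc i) * χ (suc i) * (g * e)
        ≈⟨ solve 4 (λ p x g e → p :* x :* (g :* e) := (g :* p) :* (e :* x)) refl _ _ _ _ ⟩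
      (g * ψ (suc i)) * (e * χ (suc i)) ≈⟨ *-congʳ (partFactor-ψ (2 ℕ.+ B) i K≤B) ⟩
      1# * (e * χ (suc i))             ≈⟨ *-identityˡ _ ⟩
      e * χ (suc i)                    ∎)
      where
      g = partFactor (3 ℕ.+ B) (suc i)
      e = 1# + q ^ suc i

open ≡ using (refl; sym; trans; cong; cong₂; subst; module ≡-Reasoning)

-- Truncated power series

PowerSeries : Set
PowerSeries = ℕ → ℤ

shift : PowerSeries → PowerSeries
shift f n = f (suc n)

infixl 6 _⊞_
infixl 7 _⊛_

_⊞_ : PowerSeries → PowerSeries → PowerSeries
(f ⊞ g) n = f n ℤ.+ g n

_⊛_ : PowerSeries → PowerSeries → PowerSeries
(f ⊛ g) zero    = f 0 ℤ.* g 0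
(f ⊛ g) (suc n) = f 0 ℤ.* g (suc n) ℤ.+ (shift f ⊛ g) n

constant : ℤ → PowerSeries
constant c zero    = c
constant c (suc n) = 0ℤ

X : PowerSeries
X zero    = 0ℤ
X (suc n) = constant 1ℤ n

open +-*-Solver

⊛-cong : ∀ n {f f′ g g′} → (∀ i → i ≤ n → f i ≡ f′ i) → (∀ i → i ≤ n → g i ≡ g′ i) → (f ⊛ g) n ≡ (f′ ⊛ g′) n
⊛-cong zero    ff gg = cong₂ ℤ._*_ (ff 0 z≤n) (gg 0 z≤n)
⊛-cong (suc n) ff gg = cong₂ ℤ._+_ (cong₂ ℤ._*_ (ff 0 z≤n) (gg (suc n) ℕ.≤-refl))
  (⊛-cong n (λ i i≤n → ff (suc i) (s≤s i≤n)) (λ i i≤n → gg i (ℕ.m≤n⇒m≤1+n i≤n)))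

⊛-distribʳ : ∀ n h f g → ((f ⊞ g) ⊛ h) n ≡ (f ⊛ h) n ℤ.+ (g ⊛ h) n
⊛-distribʳ zero    h f g = ℤ.*-distribʳ-+ (h 0) (f 0) (g 0)
⊛-distribʳ (suc n) h f g = trans (cong (λ x → (f 0 ℤ.+ g 0) ℤ.* h (suc n) ℤ.+ x) (⊛-distribʳ n h (shift f) (shift g)))
  (solve 5 (λ a b c x y → (a :+ b) :* c :+ (x :+ y)
      := (a :* c :+ x) :+ (b :* c :+ y)) refl (f 0) (g 0) (h (suc n)) _ _)

⊛-scale : ∀ n c f g → ((λ i → c ℤ.* f i) ⊛ g) n ≡ c ℤ.* (f ⊛ g) n
⊛-scale zero    c f g = ℤ.*-assoc c (f 0) (g 0)
⊛-scale (suc n) c f g = trans (cong (λ x → c ℤ.* f 0 ℤ.* g (suc n) ℤ.+ x) (⊛-scale n c (shift f) g))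
  (solve 4 (λ c a b x → c :* a :* b :+ c :* x := c :* (a :* b :+ x)) refl c (f 0) (g (suc n)) _)

⊛-assoc : ∀ n f g h → ((f ⊛ g) ⊛ h) n ≡ (f ⊛ (g ⊛ h)) n
⊛-assoc zero    f g h = ℤ.*-assoc (f 0) (g 0) (h 0)
⊛-assoc (suc n) f g h = begin
  f 0 ℤ.* g 0 ℤ.* h (suc n) ℤ.+ (((λ i → f 0 ℤ.* g (suc i)) ⊞ (shift f ⊛ g)) ⊛ h) n
    ≡⟨ cong (λ x → f 0 ℤ.* g 0 ℤ.* h (suc n) ℤ.+ x)
        (trans (⊛-distribʳ n h _ _) (cong₂ ℤ._+_ (⊛-scale n (f 0) (shift g) h) (⊛-assoc n (shift f) g h))) ⟩
  f 0 ℤ.* g 0 ℤ.* h (suc n) ℤ.+ (f 0 ℤ.* (shift g ⊛ h) n ℤ.+ (shift f ⊛ (g ⊛ h)) n)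
    ≡⟨ solve 5 (λ a b c x y → a :* b :* c :+ (a :* x :+ y)
        := a :* (b :* c :+ x) :+ y) refl (f 0) (g 0) (h (suc n)) _ _ ⟩
  f 0 ℤ.* (g 0 ℤ.* h (suc n) ℤ.+ (shift g ⊛ h) n) ℤ.+ (shift f ⊛ (g ⊛ h)) n ∎
  where open ≡-Reasoning

-- The product is defined by peeling the first coefficient of the left factor; commutativity needs
-- the peeling at the other end too.
⊛-last : ∀ n f g → (f ⊛ g) (suc n) ≡ (f ⊛ shift g) n ℤ.+ f (suc n) ℤ.* g 0
⊛-last zero    f g = refl
⊛-last (suc n) f g =
    trans (cong (λ x → f 0 ℤ.* g (2 ℕ.+ n) ℤ.+ x) (⊛-last n (shift f) g)) (sym (ℤ.+-assoc (f 0 ℤ.* g (2 ℕ.+ n)) _ _))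

⊛-comm : ∀ n f g → (f ⊛ g) n ≡ (g ⊛ f) n
⊛-comm zero    f g = ℤ.*-comm (f 0) (g 0)
⊛-comm (suc n) f g = begin
  f 0 ℤ.* g (suc n) ℤ.+ (shift f ⊛ g) n   ≡⟨ cong₂ ℤ._+_ (ℤ.*-comm (f 0) (g (suc n))) (⊛-comm n (shift f) g) ⟩
  g (suc n) ℤ.* f 0 ℤ.+ (g ⊛ shift f) n   ≡⟨ ℤ.+-comm _ ((g ⊛ shift f) n) ⟩
  (g ⊛ shift f) n ℤ.+ g (suc n) ℤ.* f 0   ≡⟨ ⊛-last n g f ⟨
  (g ⊛ f) (suc n)                         ∎
  where open ≡-Reasoning

⊛-zeroˡ : ∀ n g → ((λ _ → 0ℤ) ⊛ g) n ≡ 0ℤ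
⊛-zeroˡ zero    g = ℤ.*-zeroˡ (g 0)
⊛-zeroˡ (suc n) g = cong₂ ℤ._+_ (ℤ.*-zeroˡ (g (suc n))) (⊛-zeroˡ n g)

⊛-identityˡ : ∀ n g → (constant 1ℤ ⊛ g) n ≡ g n
⊛-identityˡ zero    g = ℤ.*-identityˡ (g 0)
⊛-identityˡ (suc n) g = trans (cong₂ ℤ._+_ (ℤ.*-identityˡ (g (suc n))) (⊛-zeroˡ n g)) (ℤ.+-identityʳ _)

⊛-distribˡ : ∀ n h f g → (h ⊛ (f ⊞ g)) n ≡ (h ⊛ f) n ℤ.+ (h ⊛ g) n
⊛-distribˡ n h f g = trans (⊛-comm n h (f ⊞ g))
    (trans (⊛-distribʳ n h f g) (cong₂ ℤ._+_ (⊛-comm n f h) (⊛-comm n g h)))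

-- ℤ[[q]] / (q ^ K): the same operations, with series compared below degree K only.
truncated : ℕ → CommutativeRing 0ℓ 0ℓ
truncated K = record
  { Carrier = PowerSeries
  ; _≈_ = λ f g → ∀ n → n < K → f n ≡ g n
  ; _+_ = _⊞_
  ; _*_ = _⊛_
  ; -_ = λ f n → ℤ.- f n
  ; 0# = λ _ → 0ℤ
  ; 1# = constant 1ℤ
  ; isCommutativeRing = record
    { isRing = record
      { +-isAbelianGroup = record
        { isGroup = record
          { isMonoid = record
            { isSemigroup = record
              { isMagma = record
                { isEquivalence = record
                  { refl = λ _ _ → refl
                  ; sym = λ p n n<K → sym (p n n<K)
                  ; trans = λ p q n n<K → trans (p n n<K) (q n n<K)
                  }
                ; ∙-cong = λ p q n n<K → cong₂ ℤ._+_ (p n n<K) (q n n<K)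
                }
              ; assoc = λ f g h n _ → ℤ.+-assoc (f n) (g n) (h n)
              }
            ; identity = (λ f n _ → ℤ.+-identityˡ (f n)) , (λ f n _ → ℤ.+-identityʳ (f n))
            }
          ; inverse = (λ f n _ → ℤ.+-inverseˡ (f n)) , (λ f n _ → ℤ.+-inverseʳ (f n))
          ; ⁻¹-cong = λ p n n<K → cong ℤ.-_ (p n n<K)
          }
        ; comm = λ f g n _ → ℤ.+-comm (f n) (g n)
        }
      ; *-cong = λ p q n n<K → ⊛-cong n (λ i i≤n → p i (ℕ.≤-<-trans i≤n n<K)) (λ i i≤n → q i (ℕ.≤-<-trans i≤n n<K))
      ; *-assoc = λ f g h n _ → ⊛-assoc n f g h
      ; *-identity = (λ g n _ → ⊛-identityˡ n g) , (λ g n _ → trans (⊛-comm n g (constant 1ℤ)) (⊛-identityˡ n g))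
      ; distrib = (λ h f g n _ → ⊛-distribˡ n h f g) , (λ h f g n _ → ⊛-distribʳ n h f g)
      }
    ; *-comm = λ f g n _ → ⊛-comm n f g
    }
  }

module _ (K : ℕ) where
  open Exp (CommutativeRing.semiring (truncated K))

  X^-coeff : ∀ w n → (X ^ w) n ≡ (if w ≡ᵇ n then 1ℤ else 0ℤ)
  X^-coeff zero    zero    = refl
  X^-coeff zero    (suc n) = refl
  X^-coeff (suc w) zero    = ℤ.*-zeroˡ ((X ^ w) 0)
  X^-coeff (suc w) (suc n) = trans (cong₂ ℤ._+_ (ℤ.*-zeroˡ ((X ^ w) (suc n))) (⊛-identityˡ n (X ^ w)))
    (trans (ℤ.+-identityˡ _) (X^-coeff w n))

  X^K≈0 : ∀ n → n < K → (X ^ K) n ≡ 0ℤ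
  X^K≈0 n n<K = trans (X^-coeff K n) (below K n n<K)
    where
    below : ∀ K n → n < K → (if K ≡ᵇ n then 1ℤ else 0ℤ) ≡ 0ℤ
    below (suc K) zero    _         = refl
    below (suc K) (suc n) (s≤s n<K) = below K n n<K

-- Counting frequency forms by finite sums

open Summation ℕ._+_ 0

≡⇒Fin↔ : ∀ {m n} → m ≡ n → Fin m ↔ Fin n
≡⇒Fin↔ refl = ↔-refl

⊎↔Fin : ∀ {A B : Set} {m n} → A ↔ Fin m → B ↔ Fin n → (A ⊎ B) ↔ Fin (m ℕ.+ n)
⊎↔Fin f g = ↔-trans (f ⊎-↔ g) (↔-sym +↔⊎)

Σ<-firstℕ : ∀ n f → Σ< (suc n) f ≡ f 0 ℕ.+ Σ< n (f ∘ suc)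
Σ<-firstℕ zero    f = sym (ℕ.+-identityʳ (f 0))
Σ<-firstℕ (suc n) f = trans (cong (ℕ._+ f (suc n)) (Σ<-firstℕ n f)) (ℕ.+-assoc (f 0) _ _)

Σℕ-first : (X : ℕ → Set) → Σ ℕ X ↔ (X 0 ⊎ Σ ℕ (X ∘ suc))
Σℕ-first X = mk↔ₛ′
  (λ { (zero , x) → inj₁ x ; (suc n , x) → inj₂ (n , x) })
  (λ { (inj₁ x) → zero , x ; (inj₂ (n , x)) → suc n , x })
  (λ { (inj₁ x) → refl ; (inj₂ (n , x)) → refl })
  (λ { (zero , x) → refl ; (suc n , x) → refl })

Σℕ↔Fin : ∀ B (X : ℕ → Set) c → (∀ f → X f ↔ Fin (c f)) → (∀ f → X f → f < B) → Σ ℕ X ↔ Fin (Σ< B c)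
Σℕ↔Fin zero    X c X↔ bound = mk↔ₛ′ (λ { (f , x) → ⊥-elim (ℕ.n≮0 (bound f x)) }) (λ ()) (λ ())
  (λ { (f , x) → ⊥-elim (ℕ.n≮0 (bound f x)) })
Σℕ↔Fin (suc B) X c X↔ bound = ↔-trans (Σℕ-first X) (↔-trans
  (⊎↔Fin (X↔ 0) (Σℕ↔Fin B (X ∘ suc) (c ∘ suc) (X↔ ∘ suc) (λ f x → ℕ.s<s⁻¹ (bound (suc f) x))))
  (≡⇒Fin↔ (sym (Σ<-firstℕ B c))))

-- Frequencies range over all of ℕ while the sums stop at B; a bound on the weight closes this gap.
Bounded : ℕ → ∀ N → OP N → Set
Bounded B zero    _           = ⊤
Bounded B (suc N) (_ , f , o) = f < B × Bounded B N o

ΣOP-suc : ∀ N (X : OP (suc N) → Set) →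
  Σ (OP (suc N)) X ↔ Σ (OP N) (λ o → Σ ℕ (λ f → X (false , f , o)) ⊎ Σ ℕ (λ f → X (true , f , o)))
ΣOP-suc N X = mk↔ₛ′
  (λ { ((false , f , o) , x) → o , inj₁ (f , x) ; ((true , f , o) , x) → o , inj₂ (f , x) })
  (λ { (o , inj₁ (f , x)) → (false , f , o) , x ; (o , inj₂ (f , x)) → (true , f , o) , x })
  (λ { (o , inj₁ (f , x)) → refl ; (o , inj₂ (f , x)) → refl })
  (λ { ((false , f , o) , x) → refl ; ((true , f , o) , x) → refl })

ΣOP↔Fin : ∀ B N (X : OP N → Set) c → (∀ o → X o ↔ Fin (c o)) → (∀ o → X o → Bounded B N o) →
          Σ (OP N) X ↔ Fin (ΣOP B N c)
ΣOP↔Fin B zero    X c X↔ bound = ↔-trans (mk↔ₛ′ proj₂ (tt ,_) (λ _ → refl) (λ _ → refl)) (X↔ tt)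
ΣOP↔Fin B (suc N) X c X↔ bound = ↔-trans (ΣOP-suc N X) (ΣOP↔Fin B N _ _
  (λ o → ⊎↔Fin (Σℕ↔Fin B _ _ (λ f → X↔ (false , f , o)) (λ f x → proj₁ (bound _ x)))
               (Σℕ↔Fin B _ _ (λ f → X↔ (true , f , o)) (λ f x → proj₁ (bound _ x))))
  (λ { o (inj₁ (f , x)) → proj₂ (bound _ x) ; o (inj₂ (f , x)) → proj₂ (bound _ x) }))

T↔Fin : ∀ b → T b ↔ Fin (if b then 1 else 0)
T↔Fin true  = ↔-sym 1↔⊤
T↔Fin false = ↔-sym 0↔⊥

weight-bounded : ∀ N o {n} → weight N o ≤ n → Bounded (suc n) N o
weight-bounded zero    o           w≤n = tt
weight-bounded (suc N) (b , f , o) w≤n =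
  s≤s (ℕ.≤-trans (ℕ.≤-trans (ℕ.m≤n+m f (bit b)) (ℕ.≤-trans (ℕ.m≤m*n _ (suc N)) (ℕ.m≤m+n _ _))) w≤n) ,
  weight-bounded N o (ℕ.≤-trans (ℕ.m≤n+m (weight N o) _) w≤n)

-- Overpartitions as frequencies

open import Data.Nat.Base using (_+_; _*_)

T⇒≡ : ∀ {b} → T b → b ≡ true
T⇒≡ = Equivalence.to T-≡

¬T⇒≡ : ∀ {b} → ¬ T b → b ≡ false
¬T⇒≡ {true}  ¬t = ⊥-elim (¬t tt)
¬T⇒≡ {false} _  = refl

≤ᵇ-true : ∀ {a b} → a ≤ b → (a ≤ᵇ b) ≡ true
≤ᵇ-true = T⇒≡ ∘ ℕ.≤⇒≤ᵇ

≤ᵇ-false : ∀ {a b} → b < a → (a ≤ᵇ b) ≡ false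
≤ᵇ-false {a} {b} b<a = ¬T⇒≡ (λ t → ℕ.<⇒≱ b<a (ℕ.≤ᵇ⇒≤ a b t))

≡ᵇ-false : ∀ {a b} → a < b → (a ≡ᵇ b) ≡ false
≡ᵇ-false {a} {b} a<b = ¬T⇒≡ (λ t → ℕ.<⇒≢ a<b (ℕ.≡ᵇ⇒≡ a b t))

key-plain-least : ∀ {m} x → m ≤ size x → key (m , false) ≤ key x
key-plain-least (k , b) m≤k = ℕ.+-mono-≤ (ℕ.*-monoʳ-≤ 2 m≤k) z≤n

key-over-greatest : ∀ {m} x → size x ≤ m → key x ≤ key (m , true)
key-over-greatest (k , false) k≤m = ℕ.+-mono-≤ (ℕ.*-monoʳ-≤ 2 k≤m) z≤n
key-over-greatest (k , true)  k≤m = ℕ.+-mono-≤ (ℕ.*-monoʳ-≤ 2 k≤m) ℕ.≤-refl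

key-mono-< : ∀ x y → size x < size y → key x < key y
key-mono-< x y x<y = begin-strict
  key x                  ≤⟨ key-over-greatest x ℕ.≤-refl ⟩
  2 * size x + 1         <⟨ ℕ.+-monoʳ-< (2 * size x) {1} {2} ℕ.≤-refl ⟩
  2 * size x + 2         ≡⟨ ℕ.+-comm (2 * size x) 2 ⟩
  2 + 2 * size x         ≡⟨ ℕ.*-suc 2 (size x) ⟨
  2 * suc (size x)       ≡⟨ ℕ.+-identityʳ _ ⟨
  key (suc (size x) , false) ≤⟨ key-plain-least y x<y ⟩
  key y                  ∎
  where open ℕ.≤-Reasoning

plains : ℕ → ℕ → List Part → List Part
plains m zero    r = r
plains m (suc f) r = (m , false) ∷ plains m f r

addOver : ℕ → Bool → List Part → List Part
addOver m false r = r
addOver m true  r = (m , true) ∷ r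

encode : ∀ N → OP N → List Part
encode zero    _           = []
encode (suc N) (b , f , o) = addOver (suc N) b (plains (suc N) f (encode N o))

plains-All : ∀ {P : Part → Set} m f {r} → P (m , false) → All P r → All P (plains m f r)
plains-All m zero    p ps = ps
plains-All m (suc f) p ps = p ∷ plains-All m f p ps

addOver-All : ∀ {P : Part → Set} m b {r} → P (m , true) → All P r → All P (addOver m b r)
addOver-All m false p ps = ps
addOver-All m true  p ps = p ∷ ps

encode-size≤ : ∀ N o → All (λ x → size x ≤ N) (encode N o)
encode-size≤ zero    o           = []
encode-size≤ (suc N) (b , f , o) =
  addOver-All (suc N) b ℕ.≤-refl (plains-All (suc N) f ℕ.≤-refl (All.map ℕ.m≤n⇒m≤1+n (encode-size≤ N o)))

encode-key≤ : ∀ N f o → All (λ x → key x ≤ key (suc N , false)) (plains (suc N) f (encode N o))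
encode-key≤ N f o = plains-All (suc N) f ℕ.≤-refl
  (All.map (λ {x} x≤N → ℕ.<⇒≤ (key-mono-< x (suc N , false) (s≤s x≤N))) (encode-size≤ N o))

All⇒allB : ∀ {A : Set} {p : A → Bool} {xs} → All (λ x → p x ≡ true) xs → allB p xs ≡ true
All⇒allB []         = refl
All⇒allB (px ∷ pxs) = cong₂ _∧_ px (All⇒allB pxs)

encode-allPos : ∀ N o → allPos (encode N o) ≡ true
encode-allPos N o = All⇒allB (go N o)
  where
  go : ∀ N o → All (λ x → (1 ≤ᵇ size x) ≡ true) (encode N o)
  go zero    o           = []
  go (suc N) (b , f , o) = addOver-All (suc N) b refl (plains-All (suc N) f refl (go N o))

sorted-cons : ∀ x {e} → All (λ y → key y ≤ key x) e → sortedDec e ≡ true → sortedDec (x ∷ e) ≡ true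
sorted-cons x {[]}    []       srt = refl
sorted-cons x {y ∷ r} (le ∷ _) srt = cong₂ _∧_ (≤ᵇ-true le) srt

encode-sorted : ∀ N o → sortedDec (encode N o) ≡ true
encode-sorted zero    o           = refl
encode-sorted (suc N) (b , f , o) = barred b
  where
  plain : ∀ f → sortedDec (plains (suc N) f (encode N o)) ≡ true
  plain zero    = encode-sorted N o
  plain (suc f) = sorted-cons _ (encode-key≤ N f o) (plain f)
  barred : ∀ b → sortedDec (addOver (suc N) b (plains (suc N) f (encode N o))) ≡ true
  barred false = plain f
  barred true  = sorted-cons _
    (All.map (λ le → ℕ.≤-trans le (key-over-greatest {suc N} (suc N , false) ℕ.≤-refl)) (encode-key≤ N f o)) (plain f)

encode-overDistinct : ∀ N o → overDistinct (encode N o) ≡ true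
encode-overDistinct zero    o           = refl
encode-overDistinct (suc N) (b , f , o) = barred b
  where
  plain : ∀ f → overDistinct (plains (suc N) f (encode N o)) ≡ true
  plain zero    = encode-overDistinct N o
  plain (suc f) = plain f
  different : ∀ x → size x ≤ N → not (over x ∧ (size x ≡ᵇ suc N)) ≡ true
  different x x≤N = cong not (trans (cong (over x ∧_) (≡ᵇ-false (s≤s x≤N))) (∧-zeroʳ (over x)))
  barred : ∀ b → overDistinct (addOver (suc N) b (plains (suc N) f (encode N o))) ≡ true
  barred false = plain f
  barred true  = cong₂ _∧_
    (All⇒allB (plains-All (suc N) f refl (All.map (λ {x} → different x) (encode-size≤ N o)))) (plain f)

encode-sum : ∀ N o → sum (map size (encode N o)) ≡ weight N o
encode-sum zero    o           = refl
encode-sum (suc N) (b , f , o) = barred b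
  where
  plain : ∀ f → sum (map size (plains (suc N) f (encode N o))) ≡ f * suc N + weight N o
  plain zero    = encode-sum N o
  plain (suc f) = trans (cong (λ s → suc N + s) (plain f)) (sym (ℕ.+-assoc (suc N) (f * suc N) _))
  barred : ∀ b → sum (map size (addOver (suc N) b (plains (suc N) f (encode N o)))) ≡ (bit b + f) * suc N + weight N o
  barred false = plain f
  barred true  = trans (cong (λ s → suc N + s) (plain f)) (sym (ℕ.+-assoc (suc N) (f * suc N) _))

encode-isOverpartition : ∀ n N o → isOverpartition n (encode N o) ≡ (weight N o ≡ᵇ n)
encode-isOverpartition n N o
  rewrite encode-allPos N o | encode-sorted N o | encode-overDistinct N o | encode-sum N o = refl

plains-injective : ∀ N f f′ o o′ → plains (suc N) f (encode N o) ≡ plains (suc N) f′ (encode N o′) →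
                   f ≡ f′ × encode N o ≡ encode N o′
plains-injective N zero    zero     o o′ eq = refl , eq
plains-injective N (suc f) (suc f′) o o′ eq with eq′ ← cong (λ { [] → [] ; (_ ∷ r) → r }) eq
  with refl , e ← plains-injective N f f′ o o′ eq′ = refl , e
plains-injective N zero    (suc f′) o o′ eq = ⊥-elim (ℕ.1+n≰n (All.head (subst (All _) eq (encode-size≤ N o))))
plains-injective N (suc f) zero     o o′ eq = ⊥-elim (ℕ.1+n≰n (All.head (subst (All _) (sym eq) (encode-size≤ N o′))))

plains≢over : ∀ N f o r → ¬ plains (suc N) f (encode N o) ≡ (suc N , true) ∷ r
plains≢over N zero    o r eq = ℕ.1+n≰n (All.head (subst (All _) eq (encode-size≤ N o)))
plains≢over N (suc f) o r ()

encode-injective : ∀ N o o′ → encode N o ≡ encode N o′ → o ≡ o′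
encode-injective zero    o              o′                eq = refl
encode-injective (suc N) (false , f , o) (false , f′ , o′) eq with refl , e ← plains-injective N f f′ o o′ eq =
  cong (λ o → false , f , o) (encode-injective N o o′ e)
encode-injective (suc N) (true , f , o)  (true , f′ , o′)  eq
  with refl , e ← plains-injective N f f′ o o′ (cong (λ { [] → [] ; (_ ∷ r) → r }) eq) =
  cong (λ o → true , f , o) (encode-injective N o o′ e)
encode-injective (suc N) (false , f , o) (true , f′ , o′)  eq = ⊥-elim (plains≢over N f o _ eq)
encode-injective (suc N) (true , f , o)  (false , f′ , o′) eq = ⊥-elim (plains≢over N f′ o′ _ (sym eq))

T-∧ˡ : ∀ {a b} → T (a ∧ b) → T a
T-∧ˡ = proj₁ ∘ Equivalence.to T-∧

T-∧ʳ : ∀ {a b} → T (a ∧ b) → T b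
T-∧ʳ = proj₂ ∘ Equivalence.to T-∧

-- At its own size x joins the plain parts or sets the overline; a plain part before its overlined
-- twin violates the order, a second overlined copy distinctness. A smaller x forces the top size to
-- be absent, and the search descends.
cons-surjective : ∀ N o x → 1 ≤ size x → size x ≤ N →
  T (sortedDec (x ∷ encode N o)) → T (overDistinct (x ∷ encode N o)) → Σ (OP N) λ o′ → encode N o′ ≡ x ∷ encode N o
cons-surjective zero    o           x       1≤x x≤N srt dst = ⊥-elim (ℕ.n≮0 (ℕ.≤-trans 1≤x x≤N))
cons-surjective (suc N) (b , f , o) (k , c) 1≤x x≤N srt dst with k ℕ.≟ suc N
cons-surjective (suc N) (false , f , o) (k , false) 1≤x x≤N srt dst | yes refl = (false , suc f , o) , refl
cons-surjective (suc N) (false , f , o) (k , true)  1≤x x≤N srt dst | yes refl = (true , f , o) , refl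
cons-surjective (suc N) (true  , f , o) (k , false) 1≤x x≤N srt dst | yes refl =
  ⊥-elim (ℕ.<⇒≱ (ℕ.+-monoʳ-< (2 * suc N) {0} {1} ℕ.≤-refl) (ℕ.≤ᵇ⇒≤ _ _ (T-∧ˡ srt)))
cons-surjective (suc N) (true  , f , o) (k , true)  1≤x x≤N srt dst | yes refl =
  ⊥-elim (subst (λ b → T (not b)) (T⇒≡ (ℕ.≡⇒≡ᵇ N N refl)) (T-∧ˡ (T-∧ˡ dst)))
cons-surjective (suc N) (true  , f , o) x 1≤x x≤N srt dst | no x≢ =
  ⊥-elim (ℕ.<⇒≱ (key-mono-< x (suc N , true) (ℕ.≤∧≢⇒< x≤N x≢)) (ℕ.≤ᵇ⇒≤ _ _ (T-∧ˡ srt)))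
cons-surjective (suc N) (false , suc f , o) x 1≤x x≤N srt dst | no x≢ =
  ⊥-elim (ℕ.<⇒≱ (key-mono-< x (suc N , false) (ℕ.≤∧≢⇒< x≤N x≢)) (ℕ.≤ᵇ⇒≤ _ _ (T-∧ˡ srt)))
cons-surjective (suc N) (false , zero , o) x 1≤x x≤N srt dst | no x≢
  with o′ , eq ← cons-surjective N o x 1≤x (ℕ.s≤s⁻¹ (ℕ.≤∧≢⇒< x≤N x≢)) srt dst = (false , zero , o′) , eq

empty : ∀ N → OP N
empty zero    = tt
empty (suc N) = false , 0 , empty N

encode-empty : ∀ N → encode N (empty N) ≡ []
encode-empty zero    = refl
encode-empty (suc N) = encode-empty N

sorted-tail : ∀ x π → T (sortedDec (x ∷ π)) → T (sortedDec π)
sorted-tail x []      _   = tt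
sorted-tail x (y ∷ π) srt = T-∧ʳ {y ≼ x} srt

encode-surjective : ∀ N π → All (λ x → size x ≤ N) π → T (allPos π) → T (sortedDec π) → T (overDistinct π) →
                    Σ (OP N) λ o → encode N o ≡ π
encode-surjective N []      bnd pos srt dst = empty N , encode-empty N
encode-surjective N (x ∷ π) (x≤N ∷ bnd) pos srt dst
  with o , refl ← encode-surjective N π bnd (T-∧ʳ pos) (sorted-tail x π srt) (T-∧ʳ {not (over x) ∨ allB _ π} dst) =
  cons-surjective N o x (ℕ.≤ᵇ⇒≤ 1 (size x) (T-∧ˡ pos)) x≤N srt dst

size≤sum : ∀ π → All (λ x → size x ≤ sum (map size π)) π
size≤sum []      = []
size≤sum (x ∷ π) = ℕ.m≤m+n (size x) _ ∷ All.map (λ le → ℕ.≤-trans le (ℕ.m≤n+m _ (size x))) (size≤sum π)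

-- Serves both sides of the theorem, with `E` their extra condition. No part exceeds the total n, so
-- sizes up to N ≥ n suffice.
overpartitions↔OP : ∀ n N → n ≤ N → (E : List Part → Bool) (e : OP N → Bool) → (∀ o → E (encode N o) ≡ e o) →
  Σ (List Part) (λ π → T (isOverpartition n π ∧ E π)) ↔ Σ (OP N) (λ o → T ((weight N o ≡ᵇ n) ∧ e o))
overpartitions↔OP n N n≤N E e E≗e = mk↔ₛ′
  (λ { (π , t) → config π t , subst T (pred≡ (config π t))
      (subst (λ π → T (isOverpartition n π ∧ E π)) (sym (config-encodes π t)) t) })
  (λ { (o , t) → encode N o , subst T (sym (pred≡ o)) t })
  (λ { (o , t) → Σ-T-≡ (encode-injective N _ o (config-encodes _ _)) })
  (λ { (π , t) → Σ-T-≡ (config-encodes π t) })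
  where
  pred≡ : ∀ o → (isOverpartition n (encode N o) ∧ E (encode N o)) ≡ ((weight N o ≡ᵇ n) ∧ e o)
  pred≡ o = cong₂ _∧_ (encode-isOverpartition n N o) (E≗e o)

  Σ-T-≡ : ∀ {A : Set} {P : A → Bool} {x y : A} {s : T (P x)} {t : T (P y)} → x ≡ y →
      _≡_ {A = Σ A (T ∘ P)} (x , s) (y , t)
  Σ-T-≡ {s = s} {t} refl = cong (_ ,_) (T-irrelevant s t)

  surjective : ∀ π → T (isOverpartition n π ∧ E π) → Σ (OP N) λ o → encode N o ≡ π
  surjective π t = encode-surjective N π
      (All.map (λ le → ℕ.≤-trans le (ℕ.≤-trans (ℕ.≤-reflexive sum≡n) n≤N)) (size≤sum π))
    (T-∧ˡ overp) (T-∧ˡ overp₂) (T-∧ˡ overp₃)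
    where
    overp  = T-∧ˡ {isOverpartition n π} t
    overp₂ = T-∧ʳ {allPos π} overp
    overp₃ = T-∧ʳ {sortedDec π} overp₂
    sum≡n : sum (map size π) ≡ n
    sum≡n = ℕ.≡ᵇ⇒≡ _ n (T-∧ʳ {overDistinct π} overp₃)

  config : ∀ π → T (isOverpartition n π ∧ E π) → OP N
  config π t = proj₁ (surjective π t)

  config-encodes : ∀ π t → encode N (config π t) ≡ π
  config-encodes π t = proj₂ (surjective π t)

restrictedPart : Part → Bool
restrictedPart p = over p ∨ ((size p % 5) ≡ᵇ 1) ∨ ((size p % 5) ≡ᵇ 4)

encode-restricted : ∀ N o → allB restrictedPart (encode N o) ≡ restricted N o
encode-restricted zero    o           = refl
encode-restricted (suc N) (b , f , o) = trans (drop b)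
    (trans (plain f) (cong (_∧ allows (suc N) f) (encode-restricted N o)))
  where
  drop : ∀ b → allB restrictedPart (encode (suc N) (b , f , o)) ≡ allB restrictedPart (plains (suc N) f (encode N o))
  drop false = refl
  drop true  = refl
  plain : ∀ f → allB restrictedPart (plains (suc N) f (encode N o))
      ≡ allB restrictedPart (encode N o) ∧ allows (suc N) f
  plain zero    = sym (∧-identityʳ _)
  plain (suc f) = trans (cong (±1mod5 (suc N) ∧_) (plain f)) (absorb f)
    where
    absorb : ∀ f → ±1mod5 (suc N) ∧ (allB restrictedPart (encode N o) ∧ allows (suc N) f)
        ≡ allB restrictedPart (encode N o) ∧ ±1mod5 (suc N)
    absorb zero with ±1mod5 (suc N)
    ... | true  = refl
    ... | false = sym (∧-zeroʳ _)
    absorb (suc f) with ±1mod5 (suc N)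
    ... | true  = refl
    ... | false = sym (∧-zeroʳ _)

-- The gap and parity conditions

parity : ℕ → Bool
parity zero    = false
parity (suc n) = not (parity n)

parity-+-self : ∀ n → parity (n + n) ≡ false
parity-+-self zero    = refl
parity-+-self (suc n) = trans (cong (λ k → not (parity k)) (ℕ.+-suc n n)) (trans (not-involutive _) (parity-+-self n))

%2≡bit : ∀ n → n % 2 ≡ bit (parity n)
%2≡bit 0             = refl
%2≡bit 1             = refl
%2≡bit (suc (suc n)) = begin
  (2 + n) % 2                 ≡⟨ cong (_% 2) (ℕ.+-comm 2 n) ⟩
  (n + 2) % 2                 ≡⟨ [m+n]%n≡m%n n 2 ⟩
  n % 2                       ≡⟨ %2≡bit n ⟩
  bit (parity n)              ≡⟨ cong bit (not-involutive (parity n)) ⟨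
  bit (not (not (parity n)))  ∎
  where open ≡-Reasoning

same-parity : ∀ m n → ((m % 2) ≡ᵇ (n % 2)) ≡ not (parity m xor parity n)
same-parity m n rewrite %2≡bit m | %2≡bit n with parity m | parity n
... | false | false = refl
... | false | true  = refl
... | true  | false = refl
... | true  | true  = refl

gapHead : Part → List Part → Bool
gapHead x (y ∷ z ∷ r) = if over x then succP z ≼ x else succP z ≺ x
gapHead x _           = true

parityHead : List Part → Part → List Part → Bool
parityHead π x (y ∷ r) =
  if (if over x then x ≺ succP y else x ≼ succP y)
    then (((size x + size y) % 2) ≡ᵇ ((1 + Vbar π x) % 2))
    else true
parityHead π x [] = true

gapCond-cons : ∀ x e → gapCond (x ∷ e) ≡ gapHead x e ∧ gapCond e
gapCond-cons x []          = refl
gapCond-cons x (y ∷ [])    = refl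
gapCond-cons x (y ∷ z ∷ r) = refl

parityCond-cons : ∀ π x e → parityCond π (x ∷ e) ≡ parityHead π x e ∧ parityCond π e
parityCond-cons π x []      = refl
parityCond-cons π x (y ∷ r) = refl

-- A new part in front changes no count V̄ further down if it is plain or exceeds all parts there;
-- thus conditions can be imposed as parts are added.
parityCond-irrelevant : ∀ p π {e} → All (λ x → (over p ∧ (p ≼ x)) ≡ false) e → parityCond (p ∷ π) e ≡ parityCond π e
parityCond-irrelevant p π []             = refl
parityCond-irrelevant p π {x ∷ []}    _ = refl
parityCond-irrelevant p π {x ∷ y ∷ r} (irr ∷ irrs) rewrite irr =
    cong (parityHead π x (y ∷ r) ∧_) (parityCond-irrelevant p π irrs)

admissible : List Part → Bool
admissible π = gapCond π ∧ parityCond π π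

headCond : Part → List Part → Bool
headCond x e = gapHead x e ∧ parityHead (x ∷ e) x e

∧-interchange : ∀ a b c d → (a ∧ b) ∧ (c ∧ d) ≡ (a ∧ c) ∧ (b ∧ d)
∧-interchange true  true  c     d = refl
∧-interchange true  false true  d = refl
∧-interchange true  false false d = refl
∧-interchange false b     c     d = refl

admissible-cons : ∀ x e → All (λ y → (over x ∧ (x ≼ y)) ≡ false) e → admissible (x ∷ e) ≡ headCond x e ∧ admissible e
admissible-cons x e irr = begin
  gapCond (x ∷ e) ∧ parityCond (x ∷ e) (x ∷ e)
    ≡⟨ cong₂ _∧_ (gapCond-cons x e) (parityCond-cons (x ∷ e) x e) ⟩
  (gapHead x e ∧ gapCond e) ∧ (parityHead (x ∷ e) x e ∧ parityCond (x ∷ e) e)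
    ≡⟨ ∧-interchange (gapHead x e) (gapCond e) _ _ ⟩
  headCond x e ∧ (gapCond e ∧ parityCond (x ∷ e) e)
    ≡⟨ cong (λ c → headCond x e ∧ (gapCond e ∧ c)) (parityCond-irrelevant x e irr) ⟩
  headCond x e ∧ admissible e ∎
  where open ≡-Reasoning

-- At the head of a decreasing list V̄ counts every overlined part, so one running parity is enough.
Vbar-all : ∀ x π → All (λ y → key y ≤ key x) π → Vbar π x ≡ countB over π
Vbar-all x []      []         = refl
Vbar-all x (y ∷ π) (le ∷ les) rewrite ≤ᵇ-true le | ∧-identityʳ (over y) =
  cong (λ k → (if over y then 1 else 0) + k) (Vbar-all x π les)

encode-oddOver : ∀ N o → parity (countB over (encode N o)) ≡ oddOver N o
encode-oddOver zero    o           = refl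
encode-oddOver (suc N) (b , f , o) = barred b
  where
  plain : ∀ f → parity (countB over (plains (suc N) f (encode N o))) ≡ oddOver N o
  plain zero    = encode-oddOver N o
  plain (suc f) = plain f
  barred : ∀ b → parity (countB over (encode (suc N) (b , f , o))) ≡ b xor oddOver N o
  barred false = plain f
  barred true  = cong not (plain f)

-- All that a new part of size N + 1 sees of the smaller parts: which of them have size N, not
-- whether they are overlined.
data Shape (N : ℕ) : List Part → ℕ → Set where
  below : ∀ {e} → All (λ y → size y < N) e → Shape N e 0
  top   : ∀ {y r c} → size y ≡ N → Shape N r c → Shape N (y ∷ r) (suc c)

encode-shape : ∀ N o → Shape N (encode N o) (topCount N o)
encode-shape zero    o           = below []
encode-shape (suc N) (b , f , o) = barred b
  where
  plain : ∀ f → Shape (suc N) (plains (suc N) f (encode N o)) f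
  plain zero    = below (All.map s≤s (encode-size≤ N o))
  plain (suc f) = top refl (plain f)
  barred : ∀ b → Shape (suc N) (encode (suc N) (b , f , o)) (bit b + f)
  barred false = plain f
  barred true  = top refl (plain f)

module _ (N : ℕ) where
  private
    m = suc N
    plainPart overPart : Part
    plainPart = (m , false)
    overPart  = (m , true)

  gap-plain-true : ∀ z → size z < N → (succP z ≺ plainPart) ≡ true
  gap-plain-true z z<N = ≤ᵇ-true (key-mono-< (succP z) plainPart (s≤s z<N))

  gap-plain-false : ∀ z → size z ≡ N → (succP z ≺ plainPart) ≡ false
  gap-plain-false z refl = ≤ᵇ-false (s≤s (key-plain-least (succP z) ℕ.≤-refl))

  near-plain-true : ∀ y → size y ≡ N → (plainPart ≼ succP y) ≡ true
  near-plain-true y refl = ≤ᵇ-true (key-plain-least (succP y) ℕ.≤-refl)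

  near-plain-false : ∀ y → size y < N → (plainPart ≼ succP y) ≡ false
  near-plain-false y y<N = ≤ᵇ-false (key-mono-< (succP y) plainPart (s≤s y<N))

  gap-over-true : ∀ z → size z ≤ N → (succP z ≼ overPart) ≡ true
  gap-over-true z z≤N = ≤ᵇ-true (key-over-greatest (succP z) (s≤s z≤N))

  near-over-false : ∀ y → size y ≤ N → (overPart ≺ succP y) ≡ false
  near-over-false y y≤N = ≤ᵇ-false (s≤s (key-over-greatest (succP y) (s≤s y≤N)))

  -- An overlined part is far enough from all smaller sizes, and never near in the sense of the
  -- parity condition; hence `overFits` does not ask for the count at the size below.
  headCond-over : ∀ {e} → All (λ y → size y ≤ N) e → headCond overPart e ≡ true
  headCond-over {[]} [] = refl
  headCond-over {y ∷ []} (y≤ ∷ _) rewrite near-over-false y y≤ = refl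
  headCond-over {y ∷ z ∷ r} (y≤ ∷ z≤ ∷ _) rewrite near-over-false y y≤ | gap-over-true z z≤ = refl

  module _ (v : Bool) where

    headCond-plain : ∀ {e c} → Shape N e c → parity (Vbar (plainPart ∷ e) plainPart) ≡ v →
                     headCond plainPart e ≡ fits 1 c v
    headCond-plain {[]} (below []) _ = refl
    headCond-plain {y ∷ []} (below (y< ∷ _)) _ rewrite near-plain-false y y< = refl
    headCond-plain {y ∷ z ∷ r} (below (y< ∷ z< ∷ _)) _ rewrite near-plain-false y y< | gap-plain-true z z< = refl
    headCond-plain {y ∷ r} (top refl sh) V≡ = trans
      (cong (gapHead plainPart (y ∷ r) ∧_) parity≡) (gap r sh)
      where
      -- The two sizes add up to 2N + 1, so the congruence demands an even number of overlined
      -- parts.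
      parity≡ : parityHead (plainPart ∷ y ∷ r) plainPart (y ∷ r) ≡ not v
      parity≡ rewrite near-plain-true y refl = begin
        ((m + N) % 2 ≡ᵇ (1 + Vbar (plainPart ∷ y ∷ r) plainPart) % 2)
          ≡⟨ same-parity (m + N) (1 + Vbar (plainPart ∷ y ∷ r) plainPart) ⟩
        not (not (parity (N + N)) xor not (parity (Vbar (plainPart ∷ y ∷ r) plainPart)))
          ≡⟨ cong₂ (λ a b → not (not a xor not b)) (parity-+-self N) V≡ ⟩
        not (not (not v))
          ≡⟨ not-involutive (not v) ⟩
        not v ∎
        where open ≡-Reasoning
      gap : ∀ {c} r → Shape N r c → gapHead plainPart (y ∷ r) ∧ not v ≡ fits 1 (suc c) v
      gap []      (below [])       = refl
      gap (z ∷ r) (below (z< ∷ _)) rewrite gap-plain-true z z< = refl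
      gap (z ∷ r) (top eq _)       rewrite gap-plain-false z eq = refl

    -- Equal sizes have an even sum, so the congruence demands that V̄ be odd.
    parityHead-twice : ∀ x → size x ≡ m → ∀ π r → parity (Vbar π x) ≡ v →
        (if over x then x ≺ succP plainPart else x ≼ succP plainPart) ≡ true →
                       parityHead π x (plainPart ∷ r) ≡ v
    parityHead-twice x refl π r V≡ near rewrite near = begin
      ((m + m) % 2 ≡ᵇ (1 + Vbar π x) % 2)                 ≡⟨ same-parity (m + m) (1 + Vbar π x) ⟩
      not (parity (m + m) xor not (parity (Vbar π x)))    ≡⟨ cong₂ (λ a b → not (a xor not b)) (parity-+-self m) V≡ ⟩
      not (not v)                                         ≡⟨ not-involutive v ⟩
      v                                                   ∎
      where open ≡-Reasoning

    headCond-plain-plain : ∀ {e c} → Shape N e c → parity (Vbar (plainPart ∷ plainPart ∷ e) plainPart) ≡ v →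
                           headCond plainPart (plainPart ∷ e) ≡ fits 2 c v
    headCond-plain-plain {e} sh V≡ = trans
      (cong (gapHead plainPart (plainPart ∷ e) ∧_)
        (parityHead-twice plainPart refl (plainPart ∷ plainPart ∷ e) e V≡
          (≤ᵇ-true (ℕ.<⇒≤ (key-mono-< plainPart (succP plainPart) ℕ.≤-refl)))))
      (gap e sh)
      where
      gap : ∀ {c} e → Shape N e c → gapHead plainPart (plainPart ∷ e) ∧ v ≡ fits 2 c v
      gap []      (below [])       = refl
      gap (z ∷ r) (below (z< ∷ _)) rewrite gap-plain-true z z< = refl
      gap (z ∷ r) (top eq _)       rewrite gap-plain-false z eq = refl

    headCond-over-plain : ∀ {e} → All (λ y → size y ≤ N) e → parity (Vbar (overPart ∷ plainPart ∷ e) overPart) ≡ v →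
                          headCond overPart (plainPart ∷ e) ≡ v
    headCond-over-plain {e} e≤ V≡ = cong₂ _∧_ (gap e e≤)
      (parityHead-twice overPart refl (overPart ∷ plainPart ∷ e) e V≡
        (≤ᵇ-true (key-mono-< overPart (succP plainPart) ℕ.≤-refl)))
      where
      gap : ∀ e → All (λ y → size y ≤ N) e → gapHead overPart (plainPart ∷ e) ≡ true
      gap []      []       = refl
      gap (z ∷ r) (z≤ ∷ _) = gap-over-true z z≤

  module _ (o : OP N) where
    private
      e = encode N o
      c = topCount N o
      v = oddOver N o

      Vbar-plains : ∀ f x → key plainPart ≤ key x → parity (Vbar (plains m f e) x) ≡ v
      Vbar-plains f x le = trans
        (cong parity (Vbar-all x (plains m f e) (All.map (λ le′ → ℕ.≤-trans le′ le) (encode-key≤ N f o)))) (count f)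
        where
        count : ∀ f → parity (countB over (plains m f e)) ≡ v
        count zero    = encode-oddOver N o
        count (suc f) = count f

      plain-irrelevant : ∀ r → All (λ y → (over plainPart ∧ (plainPart ≼ y)) ≡ false) r
      plain-irrelevant []      = []
      plain-irrelevant (_ ∷ r) = refl ∷ plain-irrelevant r

      over≰plain : key plainPart < key overPart
      over≰plain = ℕ.+-monoʳ-< (2 * m) {0} {1} ℕ.≤-refl

    admissible-plains : ∀ f → admissible (plains m f e) ≡ fits f c v ∧ admissible e
    admissible-plains 0 = refl
    admissible-plains 1 = trans (admissible-cons plainPart e (plain-irrelevant e))
      (cong (_∧ admissible e) (headCond-plain v (encode-shape N o) (Vbar-plains 1 plainPart ℕ.≤-refl)))
    admissible-plains 2 = begin
      admissible (plains m 2 e)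
        ≡⟨ admissible-cons plainPart (plains m 1 e) (plain-irrelevant (plains m 1 e)) ⟩
      headCond plainPart (plainPart ∷ e) ∧ admissible (plains m 1 e)
        ≡⟨ cong₂ _∧_ (headCond-plain-plain v (encode-shape N o) (Vbar-plains 2 plainPart ℕ.≤-refl))
            (admissible-plains 1) ⟩
      fits 2 c v ∧ (fits 1 c v ∧ admissible e)
        ≡⟨ absorb c ⟩
      fits 2 c v ∧ admissible e ∎
      where
      open ≡-Reasoning
      -- The upper of two plain parts needs c = 0, and then the lower one is unrestricted.
      absorb : ∀ c → fits 2 c v ∧ (fits 1 c v ∧ admissible e) ≡ fits 2 c v ∧ admissible e
      absorb zero    = refl
      absorb (suc c) = refl
    admissible-plains (suc (suc (suc f))) = trans
      (admissible-cons plainPart (plains m (2 + f) e) (plain-irrelevant (plains m (2 + f) e)))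
      (cong (λ b → (b ∧ parityHead (plains m (3 + f) e) plainPart (plains m (2 + f) e))
          ∧ admissible (plains m (2 + f) e))
        (≤ᵇ-false (s≤s (ℕ.<⇒≤ (key-mono-< plainPart (succP plainPart) ℕ.≤-refl)))))

    admissible-over : ∀ f → admissible (overPart ∷ plains m f e) ≡ overFits v true f ∧ admissible (plains m f e)
    admissible-over f = trans
      (admissible-cons overPart (plains m f e)
          (All.map (λ le → ≤ᵇ-false (ℕ.≤-<-trans le over≰plain)) (encode-key≤ N f o)))
      (cong (_∧ admissible (plains m f e)) (head f))
      where
      Vbar-over : ∀ f → parity (Vbar (overPart ∷ plains m f e) overPart) ≡ not v
      Vbar-over f rewrite ≤ᵇ-true (ℕ.≤-refl {key overPart}) = cong not (Vbar-plains f overPart (ℕ.<⇒≤ over≰plain))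
      head : ∀ f → headCond overPart (plains m f e) ≡ overFits v true f
      head 0             = headCond-over (encode-size≤ N o)
      -- V̄ counts the new overlined part itself, so the parity is `not v`.
      head 1             = headCond-over-plain (not v) (encode-size≤ N o) (Vbar-over 1)
      head (suc (suc f)) = cong (_∧ parityHead (overPart ∷ plains m (2 + f) e) overPart (plains m (2 + f) e))
        (≤ᵇ-false (key-mono-< overPart (succP plainPart) ℕ.≤-refl))

encode-admissible : ∀ N o → admissible (encode N o) ≡ good N o
encode-admissible zero    o           = refl
encode-admissible (suc N) (b , f , o) = begin
  admissible (encode (suc N) (b , f , o))
    ≡⟨ barred b ⟩
  overFits v b f ∧ admissible (plains (suc N) f (encode N o))
    ≡⟨ cong (overFits v b f ∧_) (admissible-plains N o f) ⟩
  overFits v b f ∧ (fits f c v ∧ admissible (encode N o))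
    ≡⟨ ∧-comm (overFits v b f) _ ⟩
  (fits f c v ∧ admissible (encode N o)) ∧ overFits v b f
    ≡⟨ cong (_∧ overFits v b f) (∧-comm (fits f c v) _) ⟩
  (admissible (encode N o) ∧ fits f c v) ∧ overFits v b f
    ≡⟨ ∧-assoc (admissible (encode N o)) _ _ ⟩
  admissible (encode N o) ∧ step c v b f
    ≡⟨ cong (_∧ step c v b f) (encode-admissible N o) ⟩
  good N o ∧ step c v b f ∎
  where
  open ≡-Reasoning
  c = topCount N o
  v = oddOver N o
  barred : ∀ b → admissible (encode (suc N) (b , f , o)) ≡ overFits v b f ∧ admissible (plains (suc N) f (encode N o))
  barred false = refl
  barred true  = admissible-over N o f

-- Comparison of the coefficients of q^n

private
  module Count (n N : ℕ) (N≡5M : N ≡ suc (n + suc n) * 5) where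
    B : ℕ
    B = 3 + n

    n≤N : n ≤ N
    n≤N = ℕ.≤-trans (ℕ.m≤n⇒m≤1+n (ℕ.m≤m+n n (suc n)))
      (ℕ.≤-trans (ℕ.m≤m*n (suc (n + suc n)) 5) (ℕ.≤-reflexive (sym N≡5M)))

    open Exp (CommutativeRing.semiring (truncated (suc n))) using (_^_)
    -- Precision K = n + 1 just retains the coefficient of q^n, and M = 2n + 2 is exactly 2K.
    open GeneratingFunctions (truncated (suc n)) X (suc n) (X^K≈0 (suc n)) (n + suc n) ℕ.≤-refl

    count : (OP N → Bool) → ℕ
    count e = ΣOP B N (λ o → if (weight N o ≡ᵇ n) ∧ e o then 1 else 0)

    OP↔count : ∀ e → Σ (OP N) (λ o → T ((weight N o ≡ᵇ n) ∧ e o)) ↔ Fin (count e)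
    OP↔count e = ΣOP↔Fin B N _ _ (λ o → T↔Fin ((weight N o ≡ᵇ n) ∧ e o))
      (λ o t → weight-bounded N o (ℕ.≤-trans (ℕ.≤-reflexive (ℕ.≡ᵇ⇒≡ _ n (T-∧ˡ t))) (ℕ.m≤n+m n 2)))

    coefficient : ∀ e → (Summation.ΣOP _⊞_ (λ _ → 0ℤ) B N (λ o → [ e o ] X ^ weight N o)) n ≡ + count e
    coefficient e = SummationRel.ΣOP-rel _⊞_ (λ _ → 0ℤ) _+_ 0 (λ f k → f n ≡ + k) (cong₂ ℤ._+_) refl B N
      (λ o → term (e o) (weight N o))
      where
      term : ∀ b w → ([ b ] X ^ w) n ≡ + (if (w ≡ᵇ n) ∧ b then 1 else 0)
      term false w rewrite ∧-comm (w ≡ᵇ n) false = refl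
      term true  w rewrite ∧-identityʳ (w ≡ᵇ n) = trans (X^-coeff (suc n) w n) (push (w ≡ᵇ n))
        where
        push : ∀ b → (if b then 1ℤ else 0ℤ) ≡ + (if b then 1 else 0)
        push true  = refl
        push false = refl

    count-≡ : count (good N) ≡ count (restricted N)
    count-≡ = ℤ.+-injective (trans (sym (coefficient (good N)))
      (trans (good≈restricted n (s≤s (ℕ.m≤n+m n 2)) N≡5M n ℕ.≤-refl) (coefficient (restricted N))))

    LHS↔RHS : LHS n ↔ RHS n
    LHS↔RHS =
      ↔-trans (overpartitions↔OP n N n≤N admissible (good N) (encode-admissible N))
        (↔-trans (OP↔count (good N))
          (↔-trans (≡⇒Fin↔ count-≡)
            (↔-sym (↔-trans (overpartitions↔OP n N n≤N (allB restrictedPart) (restricted N) (encode-restricted N))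
              (OP↔count (restricted N))))))

theorem1p19 : (n : ℕ) → LHS n ↔ RHS n
theorem1p19 n = Count.LHS↔RHS n _ refl
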